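{- Let $G$ be a graph. Then \[p_2(G) \leq \max\left\{\frac{v_{\mathrm{odd}}(G)}{2}, 2\left\lceil \frac{\Delta(G)}{2}\right \rceil\right\}.\]
   Context: All graphs are finite and simple. A path odd-cover of a graph $G=(V,E)$ is a collection of paths in the complete graph on $V$ (i.e. paths whose vertex sets are contained in $V$) whose edge sets have symmetric difference equal to $E$; $p_2(G)$ is the minimum cardinality of a path odd-cover of $G$. $\Delta(G)$ is the maximum degree of $G$ and $v_{\mathrm{odd}}(G)$ is the number of vertices of odd degree in $G$. -}

module Defs where

open import Data.Bool using (Bool; true; false; _∧_; _∨_; _xor_; if_then_else_)
open import Data.Nat using (ℕ; _+_; _*_; _⊔_; _%_; _/_; _≡ᵇ_; _≤_)
open import Data.Fin using (Fin; _≟_)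
open import Data.List using (List; []; _∷_; map; foldr; length; filterᵇ; allFin)
open import Data.Nat.ListAction using (sum)
open import Data.List.Relation.Unary.Unique.Propositional using (Unique)
open import Data.List.Relation.Unary.All using (All)
open import Data.Product using (Σ; _×_; ∃-syntax)
open import Relation.Nullary.Decidable using (⌊_⌋)
open import Relation.Binary.PropositionalEquality using (_≡_)

record Graph (n : ℕ) : Set where
  field
    adj    : Fin n → Fin n → Bool
    sym    : ∀ u v → adj u v ≡ adj v u
    irrefl : ∀ v → adj v v ≡ false
open Graph public

degree : ∀ {n} → Graph n → Fin n → ℕ
degree {n} G v = sum (map (λ u → if adj G v u then 1 else 0) (allFin n))

-- maximum degree Δ(G) (0 for the empty graph on no vertices)
maxDegree : ∀ {n} → Graph n → ℕ
maxDegree {n} G = foldr _⊔_ 0 (map (degree G) (allFin n))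

vOdd : ∀ {n} → Graph n → ℕ
vOdd {n} G = length (filterᵇ (λ v → degree G v % 2 ≡ᵇ 1) (allFin n))

-- a path in the complete graph on Fin n: a nonempty sequence of distinct vertices
record IsPath {n : ℕ} (P : List (Fin n)) : Set where
  field
    nonempty : 1 ≤ length P
    distinct : Unique P

pathEdge : ∀ {n} → List (Fin n) → Fin n → Fin n → Bool
pathEdge []            u v = false
pathEdge (x ∷ [])      u v = false
pathEdge (x ∷ y ∷ rest) u v =
  (⌊ x ≟ u ⌋ ∧ ⌊ y ≟ v ⌋) ∨ (⌊ x ≟ v ⌋ ∧ ⌊ y ≟ u ⌋) ∨ pathEdge (y ∷ rest) u v

symDiffEdge : ∀ {n} → List (List (Fin n)) → Fin n → Fin n → Bool
symDiffEdge Ps u v = foldr _xor_ false (map (λ P → pathEdge P u v) Ps)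

IsPathOddCover : ∀ {n} → Graph n → List (List (Fin n)) → Set
IsPathOddCover G Ps = All IsPath Ps × (∀ u v → symDiffEdge Ps u v ≡ adj G u v)

p₂≤ : ∀ {n} → Graph n → ℕ → Set
p₂≤ {n} G k = ∃[ Ps ] (IsPathOddCover G Ps × length Ps ≤ k)

{-# OPTIONS --safe #-}
-- Write k = ⌈Δ/2⌉. Orient G so that in- and outdegrees differ by at most one, and add loops so that
-- every vertex has in- and outdegree k, except that one of the two is k − 1 at each odd vertex. Split
-- the arcs into k partial injections whose sizes differ by at most one: the i-th one misses mᵢ
-- sources, so it consists of mᵢ directed paths and some cycles, and Σ mᵢ = v_odd / 2. Two paths
-- suffice to absorb all cycles, so the i-th part has an odd cover by max(mᵢ, 2) paths. As the mᵢ
-- differ by at most one, they are all ≤ 2 or all ≥ 2, so Σ max(mᵢ, 2) ≤ max(v_odd / 2, 2k).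
--
-- Both the orientation and the splitting come from one lemma: every multigraph has an orientation
-- that is balanced at every vertex, because two edges uv, uw may be replaced by the edge vw.
-- Applied to a bipartite graph, it halves a set of arcs evenly at every vertex.
module Submission where

open import Defs
open import Algebra.Bundles using (CommutativeMonoid; CommutativeRing)
import Algebra.Properties.CommutativeSemigroup as CommutativeSemigroupProperties
open import Data.Bool using (Bool; true; false; _∧_; _xor_; not; if_then_else_)
import Data.Bool.Properties as 𝔹
open import Data.Bool.Solver using (module xor-∧-Solver)
open import Data.Fin using (Fin; _≟_; _<?_)
import Data.Fin.Properties as Fin
open import Data.List
  using (List; []; _∷_; [_]; _++_; map; foldr; length; concat; concatMap; allFin; replicate; filterᵇ)
open import Data.List.Membership.Propositional using (_∈_)
open import Data.List.Membership.Propositional.Properties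
  using (∈-∃++; ∈-allFin; ∈-map⁺; ∈-map⁻; ∈-++⁺ˡ; ∈-++⁺ʳ; ∈-++⁻)
open import Data.List.Properties
  using (++-assoc; ++-identityʳ; concat-map-[_]; length-++; length-map; length-replicate; length-tabulate;
         map-id; map-∘)
open import Data.List.Relation.Binary.Permutation.Propositional
  using (_↭_; refl; prep; swap; ↭-sym; ↭-trans; ↭-reflexive; ↭⇒↭ₛ)
import Data.List.Relation.Binary.Permutation.Propositional.Properties as ↭
import Data.List.Relation.Binary.Permutation.Setoid.Properties as ↭ₛ
open import Data.List.Relation.Binary.Sublist.Propositional as ⊆ using (_⊆_; []; _∷_; _∷ʳ_; ⊆-refl)
import Data.List.Relation.Binary.Sublist.Propositional.Properties as ⊆
open import Data.List.Relation.Unary.All as All using (All; []; _∷_)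
import Data.List.Relation.Unary.All.Properties as All
open import Data.List.Relation.Unary.AllPairs as AllPairs using (AllPairs; []; _∷_)
open import Data.List.Relation.Unary.Any using (Any; here; there)
open import Data.List.Relation.Unary.Unique.Propositional using (Unique)
open import Data.List.Relation.Unary.Unique.Propositional.Properties using (allFin⁺)
open import Data.Nat
  using (ℕ; zero; suc; _+_; _*_; _∸_; _/_; _%_; _⊔_; _≡ᵇ_; _≤_; _<_; _≤?_; z≤n; s≤s; s≤s⁻¹)
open import Data.Nat.DivMod using (m*n/n≡m; m*n%n≡0; [m+kn]%n≡m%n; m≡m%n+[m/n]*n; m%n<n)
import Data.Nat.Properties as ℕ
open import Data.Nat.Solver using (module +-*-Solver)
open import Data.Product as × using (∃; ∃-syntax; ∃₂; _×_; _,_; proj₁; proj₂; map₂)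
open import Data.Sum using (_⊎_; inj₁; inj₂; [_,_]′)
import Data.Sum.Properties as ⊎
open import Function using (_∘_; id; const)
open import Level using (0ℓ)
open import Relation.Binary.Definitions using (DecidableEquality; tri<; tri≈; tri>)
open import Relation.Binary.PropositionalEquality
  using (_≡_; _≢_; refl; trans; cong; cong₂; subst; subst₂; setoid; module ≡-Reasoning)
  renaming (sym to ≡-sym)
open import Relation.Nullary using (¬_; Dec; yes; no; does; contradiction)
open import Relation.Nullary.Decidable using (⌊_⌋; isYes≗does; dec-true; dec-false; _×-dec_)

open CommutativeSemigroupProperties ℕ.+-commutativeSemigroup using (x∙yz≈y∙xz)

private variable
  A B : Set
  n : ℕ

-- Finite sums in a commutative monoid

module ListSum (M : CommutativeMonoid 0ℓ 0ℓ) where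
  open CommutativeMonoid M
    renaming (refl to ≈-refl; sym to ≈-sym; trans to ≈-trans; setoid to ≈-setoid)
  open CommutativeSemigroupProperties commutativeSemigroup using (interchange) renaming (x∙yz≈y∙xz to swap-front)
  open import Relation.Binary.Reasoning.Setoid ≈-setoid

  -- In this form `degree` and `symDiffEdge` are such sums by definition, the first over ℕ, the
  -- second over 𝔽₂, that is `Bool` with `_xor_`.
  ∑ : (A → Carrier) → List A → Carrier
  ∑ f xs = foldr _∙_ ε (map f xs)

  ∑-cong∈ : ∀ {f g : A → Carrier} xs → (∀ {x} → x ∈ xs → f x ≈ g x) → ∑ f xs ≈ ∑ g xs
  ∑-cong∈ []       f≈g = ≈-refl
  ∑-cong∈ (x ∷ xs) f≈g = ∙-cong (f≈g (here refl)) (∑-cong∈ xs (f≈g ∘ there))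

  ∑-cong : ∀ {f g : A → Carrier} xs → (∀ x → f x ≈ g x) → ∑ f xs ≈ ∑ g xs
  ∑-cong xs f≈g = ∑-cong∈ xs (λ {x} _ → f≈g x)

  ∑-ε : ∀ (xs : List A) → ∑ (λ _ → ε) xs ≈ ε
  ∑-ε []       = ≈-refl
  ∑-ε (x ∷ xs) = ≈-trans (identityˡ _) (∑-ε xs)

  ∑-++ : ∀ (f : A → Carrier) xs ys → ∑ f (xs ++ ys) ≈ ∑ f xs ∙ ∑ f ys
  ∑-++ f []       ys = ≈-sym (identityˡ _)
  ∑-++ f (x ∷ xs) ys = ≈-trans (∙-congˡ (∑-++ f xs ys)) (≈-sym (assoc _ _ _))

  ∑-∙ : ∀ (f g : A → Carrier) xs → ∑ (λ x → f x ∙ g x) xs ≈ ∑ f xs ∙ ∑ g xs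
  ∑-∙ f g []       = ≈-sym (identityˡ ε)
  ∑-∙ f g (x ∷ xs) = ≈-trans (∙-congˡ (∑-∙ f g xs)) (interchange _ _ _ _)

  ∑-map : ∀ (f : B → Carrier) (g : A → B) xs → ∑ f (map g xs) ≈ ∑ (f ∘ g) xs
  ∑-map f g []       = ≈-refl
  ∑-map f g (x ∷ xs) = ∙-congˡ (∑-map f g xs)

  ∑-concat : ∀ (f : A → Carrier) xss → ∑ f (concat xss) ≈ ∑ (∑ f) xss
  ∑-concat f []         = ≈-refl
  ∑-concat f (xs ∷ xss) = ≈-trans (∑-++ f xs _) (∙-congˡ (∑-concat f xss))

  ∑-concatMap : ∀ (f : B → Carrier) (g : A → List B) xs → ∑ f (concatMap g xs) ≈ ∑ (∑ f ∘ g) xs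
  ∑-concatMap f g xs = ≈-trans (∑-concat f (map g xs)) (∑-map (∑ f) g xs)

  ∑-swap : ∀ (f : A → B → Carrier) xs ys → ∑ (λ x → ∑ (f x) ys) xs ≈ ∑ (λ y → ∑ (λ x → f x y) xs) ys
  ∑-swap f []       ys = ≈-sym (∑-ε ys)
  ∑-swap f (x ∷ xs) ys = ≈-trans (∙-congˡ (∑-swap f xs ys)) (≈-sym (∑-∙ (f x) _ ys))

  ∑-↭ : ∀ (f : A → Carrier) {xs ys} → xs ↭ ys → ∑ f xs ≈ ∑ f ys
  ∑-↭ f refl         = ≈-refl
  ∑-↭ f (prep x p)   = ∙-congˡ (∑-↭ f p)
  ∑-↭ f (swap x y p) = ≈-trans (∙-congˡ (∙-congˡ (∑-↭ f p))) (swap-front _ _ _)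
  ∑-↭ f (_↭_.trans p q) = ≈-trans (∑-↭ f p) (∑-↭ f q)

  ∑-single : ∀ (f : A → Carrier) {u xs} → Unique xs → u ∈ xs → (∀ x → x ≢ u → f x ≈ ε) → ∑ f xs ≈ f u
  ∑-single f {u} {_ ∷ xs} (u∉ ∷ _) (here refl) f≈ε = begin
    f u ∙ ∑ f xs          ≈⟨ ∙-congˡ (∑-cong∈ xs (λ x∈ → f≈ε _ (All.lookup u∉ x∈ ∘ ≡-sym))) ⟩
    f u ∙ ∑ (λ _ → ε) xs  ≈⟨ ∙-congˡ (∑-ε xs) ⟩
    f u ∙ ε               ≈⟨ identityʳ (f u) ⟩
    f u                   ∎
  ∑-single f {u} {x ∷ xs} (x∉ ∷ uniq) (there u∈) f≈ε = begin
    f x ∙ ∑ f xs  ≈⟨ ∙-cong (f≈ε x (All.lookup x∉ u∈)) (∑-single f uniq u∈ f≈ε) ⟩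
    ε ∙ f u       ≈⟨ identityˡ (f u) ⟩
    f u           ∎

  ∑-allFin : ∀ {n} (f : Fin n → Carrier) u → (∀ x → x ≢ u → f x ≈ ε) → ∑ f (allFin n) ≈ f u
  ∑-allFin f u = ∑-single f (allFin⁺ _) (∈-allFin u)

module ℕΣ = ListSum ℕ.+-0-commutativeMonoid
module 𝔹Σ = ListSum (CommutativeRing.+-commutativeMonoid 𝔹.xor-∧-commutativeRing)

-- Counting, and numbers that differ by at most one

⟦_⟧ : Bool → ℕ
⟦ b ⟧ = if b then 1 else 0

# : (A → Bool) → List A → ℕ
# p = ℕΣ.∑ (⟦_⟧ ∘ p)

Near : ℕ → ℕ → Set
Near m n = m ≤ suc n × n ≤ suc m

Near-sym : ∀ {m n} → Near m n → Near n m
Near-sym (p , q) = q , p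

Near-+ˡ : ∀ c {m n} → Near m n → Near (c + m) (c + n)
Near-+ˡ zero    near = near
Near-+ˡ (suc c) near = let p , q = Near-+ˡ c near in s≤s p , s≤s q

Near-bits : ∀ a b → Near ⟦ a ⟧ ⟦ b ⟧
Near-bits false false = z≤n , z≤n
Near-bits false true  = z≤n , s≤s z≤n
Near-bits true  false = s≤s z≤n , z≤n
Near-bits true  true  = s≤s z≤n , s≤s z≤n

-- If the bits differ, the larger one is given to the smaller number, so the gap cannot grow beyond
-- one.
Near-+bit : ∀ a b {m n} → Near m n →
  Near (⟦ a ⟧ + m) (⟦ b ⟧ + n) ⊎ Near (⟦ b ⟧ + m) (⟦ a ⟧ + n)
Near-+bit false false near = inj₁ near
Near-+bit true  true  near = inj₁ (Near-+ˡ 1 near)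
Near-+bit true  false {m} {n} (p , q) with ℕ.≤-total m n
... | inj₁ m≤n = inj₁ (s≤s m≤n , ℕ.≤-trans q (ℕ.n≤1+n _))
... | inj₂ n≤m = inj₂ (ℕ.≤-trans p (ℕ.n≤1+n _) , s≤s n≤m)
Near-+bit false true  {m} {n} (p , q) with ℕ.≤-total m n
... | inj₁ m≤n = inj₂ (s≤s m≤n , ℕ.≤-trans q (ℕ.n≤1+n _))
... | inj₂ n≤m = inj₁ (ℕ.≤-trans p (ℕ.n≤1+n _) , s≤s n≤m)

Near-≡ : ∀ {m m′ n n′} → m ≡ m′ → n ≡ n′ → Near m n → Near m′ n′
Near-≡ = subst₂ Near

-- Lists up to permutation

∈⇒↭ : ∀ {x : A} {xs} → x ∈ xs → ∃[ ys ] xs ↭ x ∷ ys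
∈⇒↭ x∈ with ∈-∃++ x∈
... | ys , zs , refl = ys ++ zs , ↭.shift _ ys zs

concat-↭ : ∀ {xss yss : List (List A)} → xss ↭ yss → concat xss ↭ concat yss
concat-↭ refl           = refl
concat-↭ (prep xs p)    = ↭.++⁺ˡ xs (concat-↭ p)
concat-↭ (swap xs ys p) = ↭-trans (↭.shifts xs ys) (↭.++⁺ˡ ys (↭.++⁺ˡ xs (concat-↭ p)))
concat-↭ (_↭_.trans p q) = ↭-trans (concat-↭ p) (concat-↭ q)

map-↭∷ : ∀ (f : A → B) {y ys} xs → y ∷ ys ↭ map f xs → ∃₂ λ x xs′ → f x ≡ y × xs ↭ x ∷ xs′ × ys ↭ map f xs′
map-↭∷ f xs p with ∈-map⁻ f (↭.∈-resp-↭ p (here refl))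
... | x , x∈ , refl = let xs′ , q = ∈⇒↭ x∈ in
  x , xs′ , refl , q , ↭.drop-∷ (↭-trans p (↭.map⁺ f q))

-- Balanced orientations of multigraphs

module Orientation {V : Set} (_≟_ : DecidableEquality V) where

  Edge : Set
  Edge = V × V

  δ : V → V → Bool
  δ v x = does (x ≟ v)

  δ-refl : ∀ v → δ v v ≡ true
  δ-refl v = dec-true (v ≟ v) refl

  δ-≢ : ∀ {v x} → x ≢ v → δ v x ≡ false
  δ-≢ {v} {x} = dec-false (x ≟ v)

  -- The sign says whether the edge keeps its direction.
  Signed : Set → Set
  Signed I = Bool × I

  tail head : Signed Edge → V
  tail (s , x , y) = if s then x else y
  head (s , x , y) = if s then y else x

  -- For `χ = δ v` this compares the out- and indegree of `v`; a loop at `v` counts once on either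
  -- side.
  Balanced : (V → Bool) → List (Signed Edge) → Set
  Balanced χ O = Near (# (χ ∘ tail) O) (# (χ ∘ head) O)

  Balanced-↭ : ∀ χ {O O′} → O ↭ O′ → Balanced χ O → Balanced χ O′
  Balanced-↭ χ p = Near-≡ (ℕΣ.∑-↭ _ p) (ℕΣ.∑-↭ _ p)

  module _ (S : V → Bool) where

    -- Balance at `S` serves bipartite graphs: if `S` is one side, its tails are the edges directed
    -- away from it and its heads the others, so the two directions are used nearly equally often.
    Orientable : List Edge → Set
    Orientable E = ∃[ O ] map proj₂ O ↭ E × (∀ v → Balanced (δ v) O) × Balanced S O

    Orientable-↭ : ∀ {E E′} → E ↭ E′ → Orientable E → Orientable E′
    Orientable-↭ p (O , q , bal) = O , ↭-trans q p , bal

    -- Orienting e₃ = vw as v → w amounts to orienting e₁ and e₂ as v → u → w.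
    record Split (e₁ e₂ e₃ : Edge) : Set where
      field
        u     : V
        s₁ s₂ : Bool → Bool
        tails : ∀ (χ : V → Bool) s →
          ⟦ χ (tail (s₁ s , e₁)) ⟧ + ⟦ χ (tail (s₂ s , e₂)) ⟧ ≡ ⟦ χ u ⟧ + ⟦ χ (tail (s , e₃)) ⟧
        heads : ∀ (χ : V → Bool) s →
          ⟦ χ (head (s₁ s , e₁)) ⟧ + ⟦ χ (head (s₂ s , e₂)) ⟧ ≡ ⟦ χ u ⟧ + ⟦ χ (head (s , e₃)) ⟧

    -- Undoing the replacement adds one tail and one head at `u`, so for every `χ` both counts grow
    -- by the same amount `⟦ χ u ⟧`.
    unsplit : ∀ {e₁ e₂ e₃ E} → Split e₁ e₂ e₃ → Orientable (e₃ ∷ E) → Orientable (e₁ ∷ e₂ ∷ E)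
    unsplit {e₁} {e₂} {e₃} split (O , p , balδ , balS) with map-↭∷ proj₂ O (↭-sym p)
    ... | (s , _) , O′ , refl , O↭ , E↭ =
      O″ , prep e₁ (prep e₂ (↭-sym E↭)) , (λ v → bal (δ v) (balδ v)) , bal S balS
      where
      open Split split
      O″ = (s₁ s , e₁) ∷ (s₂ s , e₂) ∷ O′
      regroup : ∀ a b c d r → a + b ≡ c + d → c + (d + r) ≡ a + (b + r)
      regroup a b c d r eq =
        trans (≡-sym (ℕ.+-assoc c d r)) (trans (cong (_+ r) (≡-sym eq)) (ℕ.+-assoc a b r))
      bal : ∀ χ → Balanced χ O → Balanced χ O″
      bal χ b = Near-≡
        (regroup ⟦ χ (tail (s₁ s , e₁)) ⟧ ⟦ χ (tail (s₂ s , e₂)) ⟧ ⟦ χ u ⟧ ⟦ χ (tail (s , e₃)) ⟧ _ (tails χ s))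
        (regroup ⟦ χ (head (s₁ s , e₁)) ⟧ ⟦ χ (head (s₂ s , e₂)) ⟧ ⟦ χ u ⟧ ⟦ χ (head (s , e₃)) ⟧ _ (heads χ s))
        (Near-+ˡ ⟦ χ u ⟧ (Balanced-↭ χ O↭ b))

    _touches_ : Edge → V → Set
    (x , y) touches u = x ≡ u ⊎ y ≡ u

    touching? : ∀ u E → (∃₂ λ e E′ → e touches u × E ↭ e ∷ E′) ⊎ All (λ e → ¬ e touches u) E
    touching? u [] = inj₂ []
    touching? u ((x , y) ∷ E) with x ≟ u | y ≟ u
    ... | yes x≡u | _       = inj₁ (_ , _ , inj₁ x≡u , refl)
    ... | no _    | yes y≡u = inj₁ (_ , _ , inj₂ y≡u , refl)
    ... | no x≢u  | no y≢u with touching? u E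
    ...   | inj₁ (e , E′ , t , p) = inj₁ (e , _ , t , ↭-trans (prep _ p) (swap _ _ refl))
    ...   | inj₂ none = inj₂ ([ x≢u , y≢u ]′ ∷ none)

    -- The new edge joins `v` to the other end `w` of `e`. Since `(u , v)` is listed from `u`, it is
    -- reversed exactly when `(v , w)` keeps its direction.
    split-at : ∀ {u v} e → e touches u → ∃[ w ] Split (u , v) e (v , w)
    split-at {u} {v} (_ , w) (inj₁ refl) = w , record
      { u = u ; s₁ = not ; s₂ = id
      ; tails = λ { χ true → ℕ.+-comm ⟦ χ v ⟧ _ ; χ false → refl }
      ; heads = λ { χ true → refl ; χ false → ℕ.+-comm ⟦ χ v ⟧ _ } }
    split-at {u} {v} (w , _) (inj₂ refl) = w , record
      { u = u ; s₁ = not ; s₂ = not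
      ; tails = λ { χ true → ℕ.+-comm ⟦ χ v ⟧ _ ; χ false → refl }
      ; heads = λ { χ true → refl ; χ false → ℕ.+-comm ⟦ χ v ⟧ _ } }

    split-reverse : ∀ {u v e w} → Split (v , u) e w → Split (u , v) e w
    split-reverse {u} {v} split = record
      { u = Split.u split ; s₁ = not ∘ Split.s₁ split ; s₂ = Split.s₂ split
      ; tails = λ χ s → trans (cong (λ x → ⟦ χ x ⟧ + _) (tail-not (Split.s₁ split s))) (Split.tails split χ s)
      ; heads = λ χ s → trans (cong (λ x → ⟦ χ x ⟧ + _) (head-not (Split.s₁ split s))) (Split.heads split χ s) }
      where
      tail-not : ∀ s → tail (not s , u , v) ≡ tail (s , v , u)
      tail-not true = refl
      tail-not false = refl
      head-not : ∀ s → head (not s , u , v) ≡ head (s , v , u)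
      head-not true = refl
      head-not false = refl

    #-untouched : ∀ {u} (O : List (Signed Edge)) → All (λ e → ¬ e touches u) (map proj₂ O) →
      # (δ u ∘ tail) O ≡ 0 × # (δ u ∘ head) O ≡ 0
    #-untouched [] [] = refl , refl
    #-untouched {u} ((s , x , y) ∷ O) (none ∷ nones) with x ≟ u | y ≟ u | #-untouched O nones
    ... | yes x≡u | _ | _ = contradiction (inj₁ x≡u) none
    ... | no _ | yes y≡u | _ = contradiction (inj₂ y≡u) none
    ... | no x≢u | no y≢u | t , h with s
    ...   | true  = cong₂ _+_ (cong ⟦_⟧ (δ-≢ x≢u)) t , cong₂ _+_ (cong ⟦_⟧ (δ-≢ y≢u)) h
    ...   | false = cong₂ _+_ (cong ⟦_⟧ (δ-≢ y≢u)) t , cong₂ _+_ (cong ⟦_⟧ (δ-≢ x≢u)) h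

    -- At an end of the new edge no other edge contributes, so both counts are at most one; at every
    -- other vertex the counts do not change.
    balanced-isolated : ∀ {u v E O} → All (λ e → ¬ e touches u) E → All (λ e → ¬ e touches v) E →
      map proj₂ O ↭ E → (∀ x → Balanced (δ x) O) → ∀ s x → Balanced (δ x) ((s , u , v) ∷ O)
    balanced-isolated {u} {v} {E} {O} no-u no-v p balδ s x = cases (u ≟ x) (v ≟ x)
      where
      e : Signed Edge
      e = s , u , v

      alone : All (λ e → ¬ e touches x) E → Balanced (δ x) (e ∷ O)
      alone no-x = let t , h = #-untouched O (↭.All-resp-↭ (↭-sym p) no-x) in
        Near-≡ (pad t) (pad h) (Near-bits (δ x (tail e)) (δ x (head e)))
        where
        pad : ∀ {m n} → n ≡ 0 → m ≡ m + n
        pad refl = ≡-sym (ℕ.+-identityʳ _)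

      apart : ∀ s → u ≢ x → v ≢ x → Balanced (δ x) ((s , u , v) ∷ O)
      apart true  u≢x v≢x rewrite δ-≢ u≢x | δ-≢ v≢x = balδ x
      apart false u≢x v≢x rewrite δ-≢ u≢x | δ-≢ v≢x = balδ x

      cases : Dec (u ≡ x) → Dec (v ≡ x) → Balanced (δ x) (e ∷ O)
      cases (yes refl) _          = alone no-u
      cases (no _)     (yes refl) = alone no-v
      cases (no u≢x)   (no v≢x)   = apart s u≢x v≢x

    -- An edge touching no other edge may be oriented either way, which leaves room to balance S.
    add-isolated : ∀ {u v E} → All (λ e → ¬ e touches u) E → All (λ e → ¬ e touches v) E →
      Orientable E → Orientable ((u , v) ∷ E)
    add-isolated {u} {v} no-u no-v (O , p , balδ , balS) with Near-+bit (S u) (S v) balS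
    ... | inj₁ near = (true  , u , v) ∷ O , prep _ p , balanced-isolated no-u no-v p balδ true  , near
    ... | inj₂ near = (false , u , v) ∷ O , prep _ p , balanced-isolated no-u no-v p balδ false , near

    add-loop : ∀ {u E} → Orientable E → Orientable ((u , u) ∷ E)
    add-loop {u} (O , p , balδ , balS) =
      (true , u , u) ∷ O , prep _ p , (λ x → Near-+ˡ ⟦ δ x u ⟧ (balδ x)) , Near-+ˡ ⟦ S u ⟧ balS

    -- The bound `m` carries the recursion: the list with the new edge `(v , w)` is no part of the
    -- given one, but it is shorter. A loop adds one to both counts, and an edge that meets no other
    -- is handled by `add-isolated`.
    orient-bounded : ∀ m E → length E ≤ m → Orientable E
    orient-bounded m [] _ = [] , refl , (λ _ → z≤n , z≤n) , z≤n , z≤n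
    orient-bounded (suc m) ((u , v) ∷ E) (s≤s E≤m) with u ≟ v | touching? u E | touching? v E
    ... | yes refl | _ | _ = add-loop (orient-bounded m E E≤m)
    ... | no _ | inj₁ (e , E′ , t , p) | _ =
      let w , split = split-at e t in
      Orientable-↭ (prep _ (↭-sym p))
        (unsplit split (orient-bounded m ((v , w) ∷ E′) (subst (_≤ m) (↭.↭-length p) E≤m)))
    ... | no _ | inj₂ _ | inj₁ (e , E′ , t , p) =
      let w , split = split-at e t in
      Orientable-↭ (prep _ (↭-sym p))
        (unsplit (split-reverse split) (orient-bounded m ((u , w) ∷ E′) (subst (_≤ m) (↭.↭-length p) E≤m)))
    ... | no _ | inj₂ no-u | inj₂ no-v = add-isolated no-u no-v (orient-bounded m E E≤m)

    orient : ∀ E → Orientable E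
    orient E = orient-bounded (length E) E ℕ.≤-refl

  -- The items in P are directed from first to second end, those in Q backwards.
  module _ {I : Set} (ends : I → Edge) where

    out into : List I → List I → (V → Bool) → ℕ
    out  P Q χ = # (χ ∘ proj₁ ∘ ends) P + # (χ ∘ proj₂ ∘ ends) Q
    into P Q χ = # (χ ∘ proj₂ ∘ ends) P + # (χ ∘ proj₁ ∘ ends) Q

    -- The orientation is known only for the list of ends and up to permutation; its signs are
    -- carried back to the items themselves.
    unsign : ∀ O (L : List I) → map proj₂ O ↭ map ends L →
      ∃₂ λ P Q → L ↭ P ++ Q × ∀ χ → # (χ ∘ tail) O ≡ out P Q χ × # (χ ∘ head) O ≡ into P Q χ
    unsign [] [] p = [] , [] , refl , λ χ → refl , refl
    unsign [] (x ∷ L) p = contradiction (↭-sym p) ↭.¬x∷xs↭[]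
    unsign ((s , e) ∷ O) L p with map-↭∷ ends L p
    ... | x , L′ , refl , L↭ , p′ with unsign O L′ p′
    ...   | P , Q , L′↭ , eq with s
    ...     | true  = x ∷ P , Q , ↭-trans L↭ (prep x L′↭) , λ χ →
      let t , h = eq χ in
      trans (cong (⟦ χ (proj₁ (ends x)) ⟧ +_) t) (≡-sym (ℕ.+-assoc ⟦ χ (proj₁ (ends x)) ⟧ _ _)) ,
      trans (cong (⟦ χ (proj₂ (ends x)) ⟧ +_) h) (≡-sym (ℕ.+-assoc ⟦ χ (proj₂ (ends x)) ⟧ _ _))
    ...     | false = P , x ∷ Q , ↭-trans L↭ (↭-trans (prep x L′↭) (↭-sym (↭.shift x P Q))) , λ χ →
      let t , h = eq χ in
      trans (cong (⟦ χ (proj₂ (ends x)) ⟧ +_) t) (x∙yz≈y∙xz ⟦ χ (proj₂ (ends x)) ⟧ (# (χ ∘ proj₁ ∘ ends) P) _) ,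
      trans (cong (⟦ χ (proj₁ (ends x)) ⟧ +_) h) (x∙yz≈y∙xz ⟦ χ (proj₁ (ends x)) ⟧ (# (χ ∘ proj₂ ∘ ends) P) _)

    balanced-orientation : ∀ (S : V → Bool) L → ∃₂ λ P Q →
      L ↭ P ++ Q × (∀ v → Near (out P Q (δ v)) (into P Q (δ v))) × Near (out P Q S) (into P Q S)
    balanced-orientation S L =
      let O , p , balδ , balS = orient S (map ends L)
          P , Q , q , eq      = unsign O L p
          transfer χ b        = Near-≡ (proj₁ (eq χ)) (proj₂ (eq χ)) b
      in P , Q , q , (λ v → transfer (δ v) (balδ v)) , transfer S balS

-- Equitable splitting by decreasing sums of squares

Near? : ∀ m n → Dec (Near m n)
Near? m n = (m ≤? suc n) ×-dec (n ≤? suc m)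

sq : ℕ → ℕ
sq m = m * m

Squares↓ : (x y x′ y′ : ℕ) → Set
Squares↓ x y x′ y′ = sq x′ + sq y′ ≤ sq x + sq y × (¬ Near x y → sq x′ + sq y′ < sq x + sq y)

-- If x′ < x, then y′ ≤ x′ + 1 ≤ x ≤ y, and the sum would be too small. So x′ = x + j, y′ = x′ + i
-- and y = x + 2j + i, and the sum of squares drops by 2j(j + i). For j = 0 the pair is unchanged,
-- hence was near already.
squares-sorted : ∀ {x y x′ y′} → x ≤ y → x′ ≤ y′ → y′ ≤ suc x′ → x′ + y′ ≡ x + y → Squares↓ x y x′ y′
squares-sorted {x} {y} {x′} {y′} x≤y x′≤y′ y′≤ eq with x ≤? x′
... | no x≰x′ = contradiction eq (ℕ.<⇒≢ (ℕ.+-mono-<-≤ x′<x (ℕ.≤-trans y′≤ (ℕ.≤-trans x′<x x≤y))))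
  where x′<x = ℕ.≰⇒> x≰x′
... | yes x≤x′ with ℕ.m≤n⇒∃[o]m+o≡n x≤x′
... | j , refl with ℕ.m≤n⇒∃[o]m+o≡n x′≤y′
... | i , refl with ℕ.+-cancelˡ-≡ x (j + (x + j + i)) y (trans (≡-sym (ℕ.+-assoc x j _)) eq)
... | refl = subst (sq (x + j) + sq (x + j + i) ≤_) (gain {x} {j} {i}) (ℕ.m≤m+n _ _) , strict j refl
  where
  gain : ∀ {x j i} → (sq (x + j) + sq (x + j + i)) + 2 * j * (j + i) ≡ sq x + sq (j + (x + j + i))
  gain {x} {j} {i} = solve 3 (λ x j i →
    ((x :+ j) :* (x :+ j) :+ (x :+ j :+ i) :* (x :+ j :+ i)) :+ con 2 :* j :* (j :+ i) :=
    x :* x :+ (j :+ (x :+ j :+ i)) :* (j :+ (x :+ j :+ i))) refl x j i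
    where open +-*-Solver
  strict : ∀ j′ → j ≡ j′ → ¬ Near x (j + (x + j + i)) → sq (x + j) + sq (x + j + i) < sq x + sq (j + (x + j + i))
  strict zero refl far = contradiction
    (ℕ.≤-trans x≤y (ℕ.n≤1+n _) , subst (x + 0 + i ≤_) (cong suc (ℕ.+-identityʳ x)) y′≤) far
  strict (suc j) refl far =
    subst (sq (x + suc j) + sq (x + suc j + i) <_) (gain {x} {suc j} {i}) (ℕ.m<m+n _ (s≤s z≤n))

squares : ∀ {x y x′ y′} → Near x′ y′ → x′ + y′ ≡ x + y → Squares↓ x y x′ y′
squares {x} {y} {x′} {y′} (p , q) eq with ℕ.≤-total x y | ℕ.≤-total x′ y′
... | inj₁ x≤y | inj₁ x′≤y′ = squares-sorted x≤y x′≤y′ q eq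
... | inj₁ x≤y | inj₂ y′≤x′ rewrite ℕ.+-comm (sq x′) (sq y′) =
  squares-sorted x≤y y′≤x′ p (trans (ℕ.+-comm y′ x′) eq)
... | inj₂ y≤x | inj₁ x′≤y′ rewrite ℕ.+-comm (sq x) (sq y) =
  map₂ (_∘ (_∘ Near-sym)) (squares-sorted y≤x x′≤y′ q (trans eq (ℕ.+-comm x y)))
... | inj₂ y≤x | inj₂ y′≤x′ rewrite ℕ.+-comm (sq x) (sq y) | ℕ.+-comm (sq x′) (sq y′) =
  map₂ (_∘ (_∘ Near-sym)) (squares-sorted y≤x y′≤x′ p (trans (ℕ.+-comm y′ x′) (trans eq (ℕ.+-comm x y))))

∑-mono-≤ : ∀ {f g : A → ℕ} xs → All (λ x → f x ≤ g x) xs → ℕΣ.∑ f xs ≤ ℕΣ.∑ g xs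
∑-mono-≤ []       []       = z≤n
∑-mono-≤ (x ∷ xs) (p ∷ ps) = ℕ.+-mono-≤ p (∑-mono-≤ xs ps)

∑-mono-< : ∀ {f g : A → ℕ} {xs} → All (λ x → f x ≤ g x) xs → Any (λ x → f x < g x) xs → ℕΣ.∑ f xs < ℕΣ.∑ g xs
∑-mono-< (_ ∷ ps) (here p<)  = ℕ.+-mono-<-≤ p< (∑-mono-≤ _ ps)
∑-mono-< (p ∷ ps) (there p<) = ℕ.+-mono-≤-< p (∑-mono-< ps p<)

-- Repeatedly halving the union of two classes strictly decreases the sum of the squared counts,
-- as long as some test counts the two classes unevenly.
module Equitable {I : Set} (tests : List (I → Bool))
  (halve : ∀ L → ∃₂ λ P Q → L ↭ P ++ Q × All (λ t → Near (# t P) (# t Q)) tests) where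

  Even : List I → List I → Set
  Even X Y = All (λ t → Near (# t X) (# t Y)) tests

  Even? : ∀ X Y → Dec (Even X Y)
  Even? X Y = All.all? (λ t → Near? (# t X) (# t Y)) tests

  potential : List (List I) → ℕ
  potential Xs = ℕΣ.∑ (λ t → ℕΣ.∑ (sq ∘ # t) Xs) tests

  potential-↭ : ∀ {Xs Ys} → Xs ↭ Ys → potential Xs ≡ potential Ys
  potential-↭ p = ℕΣ.∑-cong tests (λ t → ℕΣ.∑-↭ (sq ∘ # t) p)

  -- Every test has the same total on both pairs and is near on the new one, so no summand grows; a
  -- test that was uneven on the old pair gives a strict drop.
  potential-↓ : ∀ {X Y P Q Xs} → X ++ Y ↭ P ++ Q → Even P Q → ¬ Even X Y →
    potential (P ∷ Q ∷ Xs) < potential (X ∷ Y ∷ Xs)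
  potential-↓ {X} {Y} {P} {Q} {Xs} p even uneven = ∑-mono-<
    (All.map (λ {t} near → add-≤ t (proj₁ (step t near))) even)
    (strict even (All.¬All⇒Any¬ (λ t → Near? (# t X) (# t Y)) tests uneven))
    where
    step : ∀ t → Near (# t P) (# t Q) → Squares↓ (# t X) (# t Y) (# t P) (# t Q)
    step t near = squares near
      (trans (≡-sym (ℕΣ.∑-++ _ P Q)) (trans (≡-sym (ℕΣ.∑-↭ _ p)) (ℕΣ.∑-++ _ X Y)))
    add-≤ : ∀ t → sq (# t P) + sq (# t Q) ≤ sq (# t X) + sq (# t Y) →
      ℕΣ.∑ (sq ∘ # t) (P ∷ Q ∷ Xs) ≤ ℕΣ.∑ (sq ∘ # t) (X ∷ Y ∷ Xs)
    add-≤ t le = subst₂ _≤_ (ℕ.+-assoc (sq (# t P)) _ _) (ℕ.+-assoc (sq (# t X)) _ _) (ℕ.+-monoˡ-≤ _ le)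
    add-< : ∀ t → sq (# t P) + sq (# t Q) < sq (# t X) + sq (# t Y) →
      ℕΣ.∑ (sq ∘ # t) (P ∷ Q ∷ Xs) < ℕΣ.∑ (sq ∘ # t) (X ∷ Y ∷ Xs)
    add-< t lt = subst₂ _<_ (ℕ.+-assoc (sq (# t P)) _ _) (ℕ.+-assoc (sq (# t X)) _ _) (ℕ.+-monoˡ-< _ lt)
    strict : ∀ {ts} → All (λ t → Near (# t P) (# t Q)) ts → Any (λ t → ¬ Near (# t X) (# t Y)) ts →
      Any (λ t → ℕΣ.∑ (sq ∘ # t) (P ∷ Q ∷ Xs) < ℕΣ.∑ (sq ∘ # t) (X ∷ Y ∷ Xs)) ts
    strict {t ∷ _} (near ∷ _) (here far)  = here (add-< t (proj₂ (step t near) far))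
    strict         (_ ∷ near) (there far) = there (strict near far)

  uneven-with? : ∀ X Ys → All (Even X) Ys ⊎ ∃₂ λ Y Zs → Ys ↭ Y ∷ Zs × ¬ Even X Y
  uneven-with? X [] = inj₁ []
  uneven-with? X (Y ∷ Ys) with Even? X Y | uneven-with? X Ys
  ... | no uneven | _ = inj₂ (Y , Ys , refl , uneven)
  ... | yes even  | inj₁ evens = inj₁ (even ∷ evens)
  ... | yes _     | inj₂ (Z , Zs , p , uneven) = inj₂ (Z , Y ∷ Zs , ↭-trans (prep Y p) (swap Y Z refl) , uneven)

  uneven? : ∀ Xs → AllPairs Even Xs ⊎ ∃₂ λ X Y → ∃[ Ys ] Xs ↭ X ∷ Y ∷ Ys × ¬ Even X Y
  uneven? [] = inj₁ []
  uneven? (X ∷ Xs) with uneven-with? X Xs | uneven? Xs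
  ... | inj₂ (Y , Ys , p , uneven) | _ = inj₂ (X , Y , Ys , prep X p , uneven)
  ... | inj₁ even | inj₁ evens = inj₁ (even ∷ evens)
  ... | inj₁ _    | inj₂ (Y , Z , Zs , p , uneven) = inj₂ (Y , Z , X ∷ Zs ,
    ↭-trans (prep X p) (↭-trans (swap X Y refl) (prep Y (swap X Z refl))) , uneven)

  Refinement : List I → ℕ → Set
  Refinement L k = ∃[ Xs ] length Xs ≡ k × concat Xs ↭ L × AllPairs Even Xs

  equalise : ∀ m Xs → potential Xs < m → Refinement (concat Xs) (length Xs)
  equalise (suc m) Xs (s≤s pot≤m) with uneven? Xs
  ... | inj₁ even = Xs , refl , refl , even
  ... | inj₂ (X , Y , Ys , p , uneven) with halve (X ++ Y)
  ...   | P , Q , q , even with equalise m (P ∷ Q ∷ Ys)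
            (ℕ.≤-trans (potential-↓ {X} {Y} {P} {Q} {Ys} q even uneven)
              (ℕ.≤-trans (ℕ.≤-reflexive (potential-↭ (↭-sym p))) pot≤m))
  ...     | Zs , len , cat , evens = Zs , trans len (≡-sym (↭.↭-length p)) ,
    ↭-trans cat (↭-trans union (↭-sym (concat-↭ p))) , evens
    where
    union : P ++ Q ++ concat Ys ↭ X ++ Y ++ concat Ys
    union = ↭-trans (↭-sym (↭.++-assoc P Q _)) (↭-trans (↭.++⁺ʳ _ (↭-sym q)) (↭.++-assoc X Y _))

  equitable : ∀ k L → Refinement L (suc k)
  -- All items start in one class; the other `k` classes are empty and fill up through the halving.
  equitable k L with equalise _ (L ∷ replicate k []) ℕ.≤-refl
  ... | Xs , len , cat , even = Xs , trans len (cong suc (length-replicate k)) ,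
    ↭-trans cat (↭-trans (↭.++⁺ˡ L (↭-reflexive (empty k))) (↭.++-identityʳ L)) , even
    where
    empty : ∀ k → concat (replicate k []) ≡ []
    empty zero    = refl
    empty (suc k) = empty k

-- Values strictly below and strictly above `c` would differ by at least two.
near-threshold : ∀ (f : A → ℕ) c {xs} → AllPairs (λ x y → Near (f x) (f y)) xs →
  All (λ x → f x ≤ c) xs ⊎ All (λ x → c ≤ f x) xs
near-threshold f c [] = inj₁ []
near-threshold f c {x ∷ xs} (near ∷ nears) with ℕ.<-cmp (f x) c
... | tri< fx<c _ _ = inj₁ (ℕ.<⇒≤ fx<c ∷ All.map (λ n → ℕ.≤-trans (proj₂ n) fx<c) near)
... | tri> _ _ c<fx = inj₂ (ℕ.<⇒≤ c<fx ∷ All.map (λ n → s≤s⁻¹ (ℕ.≤-trans c<fx (proj₁ n))) near)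
... | tri≈ _ refl _ with near-threshold f (f x) nears
...   | inj₁ below = inj₁ (ℕ.≤-refl ∷ below)
...   | inj₂ above = inj₂ (ℕ.≤-refl ∷ above)

∑≤length⇒All≤1 : ∀ (f : A → ℕ) xs → All (λ x → 1 ≤ f x) xs → ℕΣ.∑ f xs ≤ length xs → All (λ x → f x ≤ 1) xs
∑≤length⇒All≤1 f [] [] _ = []
∑≤length⇒All≤1 f (x ∷ xs) (p ∷ ps) le =
  ℕ.+-cancelʳ-≤ (length xs) _ _ (ℕ.≤-trans (ℕ.+-monoʳ-≤ (f x) (length≤∑ ps)) le) ∷
  ∑≤length⇒All≤1 f xs ps (s≤s⁻¹ (ℕ.≤-trans (ℕ.+-monoˡ-≤ _ p) le))
  where
  length≤∑ : ∀ {xs} → All (λ x → 1 ≤ f x) xs → length xs ≤ ℕΣ.∑ f xs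
  length≤∑ []       = z≤n
  length≤∑ (p ∷ ps) = ℕ.+-mono-≤ p (length≤∑ ps)

-- Values that are not all at most one are all at least one, and an average of at most one then
-- forces equality. This turns an even distribution of at most k arcs over k classes into at most
-- one arc per class.
near⇒All≤1 : ∀ (f : A → ℕ) xs → AllPairs (λ x y → Near (f x) (f y)) xs → ℕΣ.∑ f xs ≤ length xs →
  All (λ x → f x ≤ 1) xs
near⇒All≤1 f xs near le = [ id , (λ above → ∑≤length⇒All≤1 f xs above le) ]′ (near-threshold f 1 near)

-- Walks and cycles as edge sets over 𝔽₂

Unique-⊆ : ∀ {xs ys : List A} → xs ⊆ ys → Unique ys → Unique xs
Unique-⊆ []         []           = []
Unique-⊆ (y ∷ʳ s)   (_ ∷ uniq)   = Unique-⊆ s uniq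
Unique-⊆ (refl ∷ s) (x∉ ∷ uniq)  = ⊆.All-resp-⊆ s x∉ ∷ Unique-⊆ s uniq

Unique-↭ : ∀ {xs ys : List A} → xs ↭ ys → Unique xs → Unique ys
Unique-↭ p = ↭ₛ.Unique-resp-↭ (setoid _) (↭⇒↭ₛ p)

-- The edge set {xy} over 𝔽₂: alternating, so that loops vanish.
edge : Fin n → Fin n → Fin n → Fin n → Bool
edge x y u v = (⌊ x ≟ u ⌋ ∧ ⌊ y ≟ v ⌋) xor (⌊ x ≟ v ⌋ ∧ ⌊ y ≟ u ⌋)

-- Symmetric difference takes the place of the union in `pathEdge`, so that joining walks is
-- addition.
walk : List (Fin n) → Fin n → Fin n → Bool
walk []           u v = false
walk (x ∷ [])     u v = false
walk (x ∷ y ∷ xs) u v = edge x y u v xor walk (y ∷ xs) u v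

pathEdge-∉ : ∀ {x : Fin n} {xs} → All (x ≢_) xs → ∀ v → pathEdge xs x v ≡ false × pathEdge xs v x ≡ false
pathEdge-∉ []       v = refl , refl
pathEdge-∉ (_ ∷ []) v = refl , refl
pathEdge-∉ {x = x} {y ∷ z ∷ _} (x≢y ∷ x≢z ∷ x∉) v with y ≟ x | z ≟ x | pathEdge-∉ (x≢z ∷ x∉) v
... | yes y≡x | _ | _ = contradiction (≡-sym y≡x) x≢y
... | no _ | yes z≡x | _ = contradiction (≡-sym z≡x) x≢z
... | no _ | no _ | l , r with ⌊ y ≟ v ⌋
...   | false = l , r
...   | true  = l , r

-- The first vertex does not recur, so the first edge is neither a loop nor repeated later: at most
-- one disjunct holds, and disjunction agrees with `_xor_`.
pathEdge≡walk : ∀ {xs : List (Fin n)} → Unique xs → ∀ u v → pathEdge xs u v ≡ walk xs u v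
pathEdge≡walk []       u v = refl
pathEdge≡walk (_ ∷ []) u v = refl
pathEdge≡walk {xs = x ∷ y ∷ _} ((x≢y ∷ x∉) ∷ uniq) u v
  rewrite ≡-sym (pathEdge≡walk uniq u v) with x ≟ u | x ≟ v
... | no _     | no _     = refl
... | yes refl | yes refl with y ≟ x
...   | yes y≡x = contradiction (≡-sym y≡x) x≢y
...   | no _    = refl
pathEdge≡walk {xs = x ∷ y ∷ _} ((x≢y ∷ x∉) ∷ uniq) u v | yes refl | no _
  rewrite proj₁ (pathEdge-∉ (x≢y ∷ x∉) v) with ⌊ y ≟ v ⌋
...   | true  = refl
...   | false = refl
pathEdge≡walk {xs = x ∷ y ∷ _} ((x≢y ∷ x∉) ∷ uniq) u v | no _ | yes refl
  rewrite proj₂ (pathEdge-∉ (x≢y ∷ x∉) u) with ⌊ y ≟ u ⌋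
...   | true  = refl
...   | false = refl

edge-self : ∀ (x u v : Fin n) → edge x x u v ≡ false
edge-self x u v rewrite 𝔹.∧-comm ⌊ x ≟ v ⌋ ⌊ x ≟ u ⌋ = 𝔹.xor-same (⌊ x ≟ u ⌋ ∧ ⌊ x ≟ v ⌋)

edge-comm : ∀ (x y u v : Fin n) → edge x y u v ≡ edge y x u v
edge-comm x y u v = trans (𝔹.xor-comm (⌊ x ≟ u ⌋ ∧ ⌊ y ≟ v ⌋) _)
  (cong₂ _xor_ (𝔹.∧-comm ⌊ x ≟ v ⌋ _) (𝔹.∧-comm ⌊ x ≟ u ⌋ _))

-- Nonempty by construction, so that start and end always exist. The same type serves for cycles,
-- closed by the edge from end to start.
Walk : ℕ → Set
Walk n = Fin n × List (Fin n)

vertices : Walk n → List (Fin n)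
vertices (x , xs) = x ∷ xs

lastFrom : Fin n → List (Fin n) → Fin n
lastFrom x []       = x
lastFrom _ (y ∷ xs) = lastFrom y xs

end : Walk n → Fin n
end (x , xs) = lastFrom x xs

-- On one or two vertices this is the empty edge set: a loop vanishes and a double edge cancels.
cycle : Walk n → Fin n → Fin n → Bool
cycle C u v = walk (vertices C) u v xor edge (end C) (proj₁ C) u v

-- The closing edge of a cycle as a vertex list; the one-vertex cycle is kept apart so that its
-- vertex is not repeated.
chord : Walk n → List (Fin n)
chord (x , [])     = x ∷ []
chord (x , y ∷ xs) = x ∷ end (y , xs) ∷ []

endOfAll : Fin n → List (Walk n) → Fin n
endOfAll q []       = q
endOfAll q (C ∷ Cs) = endOfAll (end C) Cs

end-⊆ : ∀ (x : Fin n) xs → [ end (x , xs) ] ⊆ x ∷ xs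
end-⊆ x []       = ⊆-refl
end-⊆ x (y ∷ xs) = x ∷ʳ end-⊆ y xs

chord-⊆ : ∀ (C : Walk n) → chord C ⊆ vertices C
chord-⊆ (x , [])     = ⊆-refl
chord-⊆ (x , y ∷ xs) = refl ∷ end-⊆ y xs

chords-⊆ : ∀ (Cs : List (Walk n)) → concatMap chord Cs ⊆ concatMap vertices Cs
chords-⊆ []       = []
chords-⊆ (C ∷ Cs) = ⊆.++⁺ (chord-⊆ C) (chords-⊆ Cs)

module _ (u v : Fin n) where
  open xor-∧-Solver

  private
    w : List (Fin n) → Bool
    w xs = walk xs u v

  -- Repeating the last vertex of the first list in front of the second keeps the connecting edge.
  walk-++ : ∀ x xs ys → w (x ∷ xs ++ ys) ≡ w (x ∷ xs) xor w (end (x , xs) ∷ ys)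
  walk-++ x []       ys = refl
  walk-++ x (y ∷ xs) ys = trans (cong (edge x y u v xor_) (walk-++ y xs ys))
    (≡-sym (𝔹.xor-assoc (edge x y u v) _ _))

  -- Running through the cycles along their vertices or along their chords uses the same connecting
  -- edges, which therefore cancel.
  detour : ∀ q Cs ys zs →
    w (q ∷ concatMap vertices Cs ++ ys) xor w (q ∷ concatMap chord Cs ++ zs)
    ≡ 𝔹Σ.∑ (λ C → cycle C u v) Cs xor (w (endOfAll q Cs ∷ ys) xor w (endOfAll q Cs ∷ zs))
  detour q [] ys zs = refl
  detour q ((x , []) ∷ Cs) ys zs rewrite edge-self x u v = trans
    (solve 3 (λ e a b → (e :+ a) :+ (e :+ b) := a :+ b) refl (edge q x u v) _ _)
    (detour x Cs ys zs)
  detour q (C@(x , y ∷ xs) ∷ Cs) ys zs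
    rewrite ++-assoc (y ∷ xs) (concatMap vertices Cs) ys
          | walk-++ x (y ∷ xs) (concatMap vertices Cs ++ ys)
          | edge-comm (end (y , xs)) x u v = begin
    (e xor (c xor a)) xor (e xor (l xor b))
      ≡⟨ solve 5 (λ e c a l b → (e :+ (c :+ a)) :+ (e :+ (l :+ b)) := (c :+ l) :+ (a :+ b)) refl e c a l b ⟩
    (c xor l) xor (a xor b)
      ≡⟨ cong ((c xor l) xor_) (detour (end C) Cs ys zs) ⟩
    (c xor l) xor (s xor t)
      ≡⟨ 𝔹.xor-assoc (c xor l) s t ⟨
    ((c xor l) xor s) xor t ∎
    where
    open ≡-Reasoning
    e = edge q x u v
    c = w (vertices C)
    l = edge x (end C) u v
    a = w (end C ∷ concatMap vertices Cs ++ ys)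
    b = w (end C ∷ concatMap chord Cs ++ zs)
    s = 𝔹Σ.∑ (λ C → cycle C u v) Cs
    t = w (endOfAll (end C) Cs ∷ ys) xor w (endOfAll (end C) Cs ∷ zs)

  detour-closed : ∀ q Cs → w (q ∷ concatMap vertices Cs) xor w (q ∷ concatMap chord Cs)
    ≡ 𝔹Σ.∑ (λ C → cycle C u v) Cs
  detour-closed q Cs = trans
    (cong₂ (λ xs ys → w (q ∷ xs) xor w (q ∷ ys))
      (≡-sym (++-identityʳ (concatMap vertices Cs))) (≡-sym (++-identityʳ (concatMap chord Cs))))
    (trans (detour q Cs [] []) (𝔹.xor-identityʳ _))

-- Covering disjoint paths and cycles by paths

walks : List (List (Fin n)) → Fin n → Fin n → Bool
walks Ps u v = 𝔹Σ.∑ (λ P → walk P u v) Ps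

CoveredBy : (Fin n → Fin n → Bool) → ℕ → Set
CoveredBy f k = ∃[ Ps ] All IsPath Ps × (∀ u v → symDiffEdge Ps u v ≡ f u v) × length Ps ≤ k

walks-cover : ∀ {f : Fin n → Fin n → Bool} {k} Ps → All (λ P → 1 ≤ length P × Unique P) Ps →
  (∀ u v → walks Ps u v ≡ f u v) → length Ps ≤ k → CoveredBy f k
walks-cover Ps paths eq len =
  Ps , All.map (λ p → record { nonempty = proj₁ p ; distinct = proj₂ p }) paths ,
  (λ u v → trans (𝔹Σ.∑-cong∈ Ps (λ P∈ → pathEdge≡walk (proj₂ (All.lookup paths P∈)) u v)) (eq u v)) , len

parity : List (Walk n) → List (Walk n) → Fin n → Fin n → Bool
parity Qs Cs u v = 𝔹Σ.∑ (λ Q → walk (vertices Q) u v) Qs xor 𝔹Σ.∑ (λ C → cycle C u v) Cs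

-- The paths q₁…q₁′ a₁…b₁ … aᵣ…bᵣ q₂ and q₁′ a₁b₁ … aᵣbᵣ q₂…q₂′, for cycles aᵢ…bᵢ.
cover-paths-cycles : ∀ (Qs Cs : List (Walk n)) → Unique (concatMap vertices Qs ++ concatMap vertices Cs) →
  CoveredBy (parity Qs Cs) (length Qs ⊔ 2)
cover-paths-cycles [] [] uniq = [] , [] , (λ u v → refl) , z≤n
-- Without paths, the first cycle opens both lists: one runs along its vertices, the other along its
-- chord, and both leave from its end.
cover-paths-cycles [] ((x , []) ∷ Cs) uniq =
  walks-cover ((x ∷ concatMap vertices Cs) ∷ (x ∷ concatMap chord Cs) ∷ [])
    ((s≤s z≤n , uniq) ∷ (s≤s z≤n , Unique-⊆ (refl ∷ chords-⊆ Cs) uniq) ∷ [])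
    eq ℕ.≤-refl
  where
  eq : ∀ u v →
    walks ((x ∷ concatMap vertices Cs) ∷ (x ∷ concatMap chord Cs) ∷ []) u v
    ≡ parity [] ((x , []) ∷ Cs) u v
  eq u v rewrite 𝔹.xor-identityʳ (walk (x ∷ concatMap chord Cs) u v) | edge-self x u v = detour-closed u v x Cs
cover-paths-cycles [] (C@(x , y ∷ xs) ∷ Cs) uniq =
  walks-cover ((vertices C ++ concatMap vertices Cs) ∷ (chord C ++ concatMap chord Cs) ∷ [])
    ((s≤s z≤n , uniq) ∷ (s≤s z≤n , Unique-⊆ (⊆.++⁺ (chord-⊆ C) (chords-⊆ Cs)) uniq) ∷ [])
    eq ℕ.≤-refl
  where
  open xor-∧-Solver
  eq : ∀ u v →
    walks ((vertices C ++ concatMap vertices Cs) ∷ (chord C ++ concatMap chord Cs) ∷ []) u v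
    ≡ parity [] (C ∷ Cs) u v
  eq u v rewrite walk-++ u v x (y ∷ xs) (concatMap vertices Cs) | edge-comm (end C) x u v
               | ≡-sym (detour-closed u v (end C) Cs) =
    solve 4 (λ c a l b → (c :+ a) :+ ((l :+ b) :+ con false) := (c :+ l) :+ (a :+ b)) refl
      (walk (vertices C) u v) _ (edge x (end C) u v) _
-- With a single path, the second list starts at the end of `Q`, and both lists stop after the last
-- cycle.
cover-paths-cycles (Q@(x , xs) ∷ []) Cs uniq =
  walks-cover ((vertices Q ++ concatMap vertices Cs) ∷ (end Q ∷ concatMap chord Cs) ∷ [])
    ((s≤s z≤n , uniq′) ∷ (s≤s z≤n , Unique-⊆ (⊆.++⁺ (end-⊆ x xs) (chords-⊆ Cs)) uniq′) ∷ [])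
    eq ℕ.≤-refl
  where
  open xor-∧-Solver
  uniq′ : Unique (vertices Q ++ concatMap vertices Cs)
  uniq′ = subst (λ ys → Unique (ys ++ concatMap vertices Cs)) (++-identityʳ (vertices Q)) uniq
  eq : ∀ u v →
    walks ((vertices Q ++ concatMap vertices Cs) ∷ (end Q ∷ concatMap chord Cs) ∷ []) u v
    ≡ parity (Q ∷ []) Cs u v
  eq u v rewrite walk-++ u v x xs (concatMap vertices Cs) | ≡-sym (detour-closed u v (end Q) Cs) =
    solve 3 (λ c a b → (c :+ a) :+ (b :+ con false) := (c :+ con false) :+ (a :+ b)) refl
      (walk (vertices Q) u v) _ _
cover-paths-cycles (Q@(x , xs) ∷ R@(y , ys) ∷ Qs) Cs uniq =
  walks-cover ((vertices Q ++ as ++ [ y ]) ∷ (end Q ∷ bs ++ vertices R) ∷ map vertices Qs)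
    -- Both lists are sublists of the distinct vertices of `Q`, the cycles and `R`, in this order.
    ((s≤s z≤n , Unique-⊆ (⊆.++⁺ (⊆-refl {x = vertices Q}) (⊆.++⁺ (⊆-refl {x = as}) (refl ∷ ⊆.minimum ys))) uniq′)
    ∷ (s≤s z≤n , Unique-⊆ (⊆.++⁺ (end-⊆ x xs) (⊆.++⁺ (chords-⊆ Cs) (⊆-refl {x = vertices R}))) uniq′)
    ∷ All.map⁺ (paths Qs (Unique-⊆ rest-⊆ uniq)))
    eq (s≤s (s≤s (ℕ.≤-trans (ℕ.≤-reflexive (length-map vertices Qs)) (ℕ.m≤m⊔n (length Qs) 0))))
  where
  open xor-∧-Solver
  as = concatMap vertices Cs
  bs = concatMap chord Cs
  ps = concatMap vertices Qs
  rest-⊆ : ps ⊆ (vertices Q ++ vertices R ++ ps) ++ as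
  rest-⊆ = ⊆.++⁺ʳ as (⊆.++⁺ˡ (vertices Q) (⊆.++⁺ˡ (vertices R) ⊆-refl))
  uniq′ : Unique (vertices Q ++ as ++ vertices R)
  uniq′ = Unique-↭ (↭.++⁺ˡ (vertices Q) (↭.++-comm (vertices R) as))
    (subst Unique (++-assoc (vertices Q) (vertices R) as)
      (Unique-⊆ (⊆.++⁺ (⊆.++⁺ (⊆-refl {x = vertices Q}) (⊆.++⁺ʳ ps ⊆-refl)) ⊆-refl) uniq))
  paths : ∀ Qs → Unique (concatMap vertices Qs) → All (λ Q → 1 ≤ length (vertices Q) × Unique (vertices Q)) Qs
  paths []       _    = []
  paths (Q ∷ Qs) uniq =
    (s≤s z≤n , Unique-⊆ (⊆.++⁺ʳ _ ⊆-refl) uniq) ∷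
    paths Qs (Unique-⊆ (⊆.++⁺ˡ (vertices Q) ⊆-refl) uniq)
  eq : ∀ u v →
    walks ((vertices Q ++ as ++ [ y ]) ∷ (end Q ∷ bs ++ vertices R) ∷ map vertices Qs) u v
    ≡ parity (Q ∷ R ∷ Qs) Cs u v
  eq u v rewrite walk-++ u v x xs (as ++ [ y ]) | 𝔹Σ.∑-map (λ P → walk P u v) vertices Qs = begin
    (q xor a) xor (b xor p)
      ≡⟨ solve 4 (λ q a b p → (q :+ a) :+ (b :+ p) := (a :+ b) :+ (q :+ p)) refl q a b p ⟩
    (a xor b) xor (q xor p)
      ≡⟨ cong (_xor (q xor p)) (detour u v (end Q) Cs [ y ] (vertices R)) ⟩
    (c xor ((l xor false) xor (l xor r))) xor (q xor p)
      -- The edge `l`, by which both lists reach `y`, cancels.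
      ≡⟨ solve 5 (λ c l r q p → (c :+ ((l :+ con false) :+ (l :+ r))) :+ (q :+ p) := (q :+ (r :+ p)) :+ c)
           refl c l r q p ⟩
    (q xor (r xor p)) xor c ∎
    where
    open ≡-Reasoning
    q = walk (vertices Q) u v
    r = walk (vertices R) u v
    p = 𝔹Σ.∑ (λ P → walk (vertices P) u v) Qs
    a = walk (end Q ∷ as ++ [ y ]) u v
    b = walk (end Q ∷ bs ++ vertices R) u v
    c = 𝔹Σ.∑ (λ C → cycle C u v) Cs
    l = edge (endOfAll (end Q) Cs) y u v

-- Decomposing a partial injection into paths and cycles

arcs : List (Fin n × Fin n) → Fin n → Fin n → Bool
arcs F u v = 𝔹Σ.∑ (λ (x , y) → edge x y u v) F

-- Every vertex is either the source of an arc or the end of a path, and either a target or a start.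
-- Isolated vertices count as paths, so there are exactly as many paths as missed sources.
record Decomposition (F : List (Fin n × Fin n)) (Qs Cs : List (Walk n)) : Set where
  field
    disjoint : Unique (concatMap vertices Qs ++ concatMap vertices Cs)
    ends     : map end Qs ++ map proj₁ F ↭ allFin n
    starts   : map proj₁ Qs ++ map proj₂ F ↭ allFin n
    parities : ∀ u v → parity Qs Cs u v ≡ arcs F u v

lastFrom-++ : ∀ (x : Fin n) xs y ys → lastFrom x (xs ++ y ∷ ys) ≡ lastFrom y ys
lastFrom-++ x []       y ys = refl
lastFrom-++ x (z ∷ xs) y ys = lastFrom-++ z xs y ys

decomposition-↭ : ∀ {F} {Qs Qs′ Cs : List (Walk n)} → Qs ↭ Qs′ → Decomposition F Qs Cs → Decomposition F Qs′ Cs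
decomposition-↭ {Cs = Cs} p D = record
  { disjoint = Unique-↭ (↭.++⁺ʳ _ (concat-↭ (↭.map⁺ vertices p))) disjoint
  ; ends     = ↭-trans (↭.++⁺ʳ _ (↭.map⁺ end (↭-sym p))) ends
  ; starts   = ↭-trans (↭.++⁺ʳ _ (↭.map⁺ proj₁ (↭-sym p))) starts
  ; parities = λ u v → trans (cong (_xor 𝔹Σ.∑ (λ C → cycle C u v) Cs) (𝔹Σ.∑-↭ _ (↭-sym p))) (parities u v) }
  where open Decomposition D

close-cycle : ∀ {F Q} {Qs Cs : List (Walk n)} → Decomposition F (Q ∷ Qs) Cs →
  Decomposition ((end Q , proj₁ Q) ∷ F) Qs (Q ∷ Cs)
close-cycle {F = F} {Q} {Qs} {Cs} D = record
  { disjoint = Unique-↭ (↭-trans (↭.++⁺ʳ _ (↭.++-comm (vertices Q) (concatMap vertices Qs)))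
                 (↭.++-assoc (concatMap vertices Qs) (vertices Q) _)) disjoint
  ; ends     = ↭-trans (↭.shift (end Q) (map end Qs) _) ends
  ; starts   = ↭-trans (↭.shift (proj₁ Q) (map proj₁ Qs) _) starts
  ; parities = λ u v → trans
      (solve 4 (λ p q e c → p :+ ((q :+ e) :+ c) := e :+ ((q :+ p) :+ c)) refl
        (𝔹Σ.∑ (λ Q → walk (vertices Q) u v) Qs) (walk (vertices Q) u v) (edge (end Q) (proj₁ Q) u v) _)
      (cong (edge (end Q) (proj₁ Q) u v xor_) (parities u v)) }
  where
  open Decomposition D
  open xor-∧-Solver

join : Walk n → Walk n → Walk n
join (x , xs) R = x , xs ++ vertices R

join-paths : ∀ {F Q R} {Qs Cs : List (Walk n)} → Decomposition F (Q ∷ R ∷ Qs) Cs →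
  Decomposition ((end Q , proj₁ R) ∷ F) (join Q R ∷ Qs) Cs
join-paths {F = F} {Q@(x , xs)} {R@(y , ys)} {Qs} {Cs} D = record
  { disjoint = subst (λ vs → Unique (vs ++ concatMap vertices Cs))
      (≡-sym (++-assoc (vertices Q) (vertices R) (concatMap vertices Qs))) disjoint
  ; ends     = subst (λ z → z ∷ map end Qs ++ end Q ∷ map proj₁ F ↭ allFin _) (≡-sym (lastFrom-++ x xs y ys))
      (↭-trans (↭-trans (prep (end R) (↭.shift (end Q) (map end Qs) _)) (swap (end R) (end Q) refl)) ends)
  ; starts   = ↭-trans (prep x (↭.shift y (map proj₁ Qs) _)) starts
  ; parities = λ u v → trans
      (cong (λ b → (b xor _) xor _) (walk-++ u v x xs (y ∷ ys)))
      (trans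
        (solve 5 (λ q e r p c → ((q :+ (e :+ r)) :+ p) :+ c := e :+ ((q :+ (r :+ p)) :+ c)) refl
          (walk (vertices Q) u v) (edge (end Q) y u v) (walk (vertices R) u v)
          (𝔹Σ.∑ (λ Q → walk (vertices Q) u v) Qs) _)
        (cong (edge (end Q) y u v xor_) (parities u v))) }
  where
  open Decomposition D
  open xor-∧-Solver

∈-left : ∀ {x : Fin n} {xs ys} → xs ++ ys ↭ allFin n → All (x ≢_) ys → x ∈ xs
∈-left {xs = xs} p x∉ with ∈-++⁻ xs (↭.∈-resp-↭ (↭-sym p) (∈-allFin _))
... | inj₁ x∈ = x∈
... | inj₂ x∈ = contradiction refl (All.lookup x∉ x∈)

-- Starting from one-vertex paths, the arcs are inserted one by one. The source of a new arc is not
-- a source yet, so it ends a path `Q`; likewise its target starts a path. If that path is `Q`, a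
-- cycle closes, otherwise two paths are joined.
decompose : ∀ (F : List (Fin n × Fin n)) → Unique (map proj₁ F) → Unique (map proj₂ F) → ∃₂ (Decomposition F)
decompose {n} [] [] [] = map (_, []) (allFin n) , [] , record
  { disjoint = subst Unique
      (≡-sym (trans (++-identityʳ _) (trans (cong concat (≡-sym (map-∘ (allFin n)))) (concat-map-[ allFin n ]))))
      (allFin⁺ n)
  ; ends     = ↭-reflexive (trans (++-identityʳ _) (trans (≡-sym (map-∘ (allFin n))) (map-id (allFin n))))
  ; starts   = ↭-reflexive (trans (++-identityʳ _) (trans (≡-sym (map-∘ (allFin n))) (map-id (allFin n))))
  ; parities = λ u v → trans (𝔹.xor-identityʳ _) (trans (𝔹Σ.∑-map _ _ (allFin n)) (𝔹Σ.∑-ε (allFin n))) }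
decompose ((x , y) ∷ F) (x∉ ∷ uniq₁) (y∉ ∷ uniq₂) with decompose F uniq₁ uniq₂
... | Qs , Cs , D with ∈-map⁻ end (∈-left (Decomposition.ends D) x∉)
... | Q , Q∈ , refl with ∈⇒↭ Q∈
... | Qs′ , Qs↭ with decomposition-↭ Qs↭ D
... | D′ with ∈-map⁻ proj₁ {xs = Q ∷ Qs′} (∈-left (Decomposition.starts D′) y∉)
... | _ , here refl , refl = Qs′ , Q ∷ Cs , close-cycle D′
... | R , there R∈ , refl with ∈⇒↭ R∈
... | Qs″ , Qs′↭ = join Q R ∷ Qs″ , Cs , join-paths (decomposition-↭ (prep Q Qs′↭) D′)

cover-partial-injection : ∀ (F : List (Fin n × Fin n)) → Unique (map proj₁ F) → Unique (map proj₂ F) →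
  ∃[ m ] m + length F ≡ n × CoveredBy (arcs F) (m ⊔ 2)
cover-partial-injection {n} F uniq₁ uniq₂ with decompose F uniq₁ uniq₂
... | Qs , Cs , D with cover-paths-cycles Qs Cs (Decomposition.disjoint D)
... | Ps , paths , eq , len =
  length Qs , size , Ps , paths , (λ u v → trans (eq u v) (Decomposition.parities D u v)) , len
  where
  open ≡-Reasoning
  size : length Qs + length F ≡ n
  size = begin
    length Qs + length F                          ≡⟨ cong₂ _+_ (length-map end Qs) (length-map proj₁ F) ⟨
    length (map end Qs) + length (map proj₁ F)    ≡⟨ length-++ (map end Qs) ⟨
    length (map end Qs ++ map proj₁ F)            ≡⟨ ↭.↭-length (Decomposition.ends D) ⟩
    length (allFin n)                             ≡⟨ length-tabulate id ⟩
    n                                             ∎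

-- A balanced orientation of the graph

open module FinOrientation {n} = Orientation (_≟_ {n}) using (δ; δ-refl; δ-≢)

Arc : ℕ → Set
Arc n = Fin n × Fin n

outdeg indeg : Fin n → List (Arc n) → ℕ
outdeg v = # (δ v ∘ proj₁)
indeg  v = # (δ v ∘ proj₂)

module _ (G : Graph n) where

  forward : Fin n → Fin n → Bool
  forward x y = does (x <? y) ∧ adj G x y

  edges : List (Arc n)
  edges = concatMap (λ x → concatMap (λ y → if forward x y then (x , y) ∷ [] else []) (allFin n)) (allFin n)

  forward-xor : ∀ u v → forward u v xor forward v u ≡ adj G u v
  forward-xor u v with Fin.<-cmp u v
  ... | tri< u<v _ v≮u rewrite dec-true (u <? v) u<v | dec-false (v <? u) v≮u = 𝔹.xor-identityʳ _
  ... | tri> u≮v _ v<u rewrite dec-true (v <? u) v<u | dec-false (u <? v) u≮v = Graph.sym G v u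
  ... | tri≈ u≮v refl _ rewrite dec-false (u <? u) u≮v = ≡-sym (irrefl G u)

  forward-+ : ∀ u v → ⟦ forward u v ⟧ + ⟦ forward v u ⟧ ≡ ⟦ adj G u v ⟧
  forward-+ u v with Fin.<-cmp u v
  ... | tri< u<v _ v≮u rewrite dec-true (u <? v) u<v | dec-false (v <? u) v≮u = ℕ.+-identityʳ _
  ... | tri> u≮v _ v<u rewrite dec-true (v <? u) v<u | dec-false (u <? v) u≮v = cong ⟦_⟧ (Graph.sym G v u)
  ... | tri≈ u≮v refl _ rewrite dec-false (u <? u) u≮v = cong ⟦_⟧ (≡-sym (irrefl G u))

  -- Generic in the monoid because degrees are sums in ℕ and adjacency is a sum in 𝔽₂ over the same
  -- list.
  module EdgeSum (M : CommutativeMonoid 0ℓ 0ℓ) where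
    open CommutativeMonoid M renaming (refl to ≈-refl; sym to ≈-sym; trans to ≈-trans; setoid to ≈-setoid)
    open ListSum M
    open import Relation.Binary.Reasoning.Setoid ≈-setoid

    guarded : (Arc n → Carrier) → Fin n → Fin n → Carrier
    guarded f x y = if forward x y then f (x , y) else ε

    guarded-ε : ∀ {f : Arc n → Carrier} x y → f (x , y) ≈ ε → guarded f x y ≈ ε
    guarded-ε x y f≈ε with forward x y
    ... | true  = f≈ε
    ... | false = ≈-refl

    ∑-edges : ∀ f → ∑ f edges ≈ ∑ (λ x → ∑ (guarded f x) (allFin n)) (allFin n)
    ∑-edges f = ≈-trans (∑-concatMap f _ (allFin n)) (∑-cong (allFin n) (λ x →
      ≈-trans (∑-concatMap f _ (allFin n)) (∑-cong (allFin n) (λ y → ∑-guard x y))))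
      where
      ∑-guard : ∀ x y → ∑ f (if forward x y then (x , y) ∷ [] else []) ≈ guarded f x y
      ∑-guard x y with forward x y
      ... | true  = identityʳ _
      ... | false = ≈-refl

    ∑-edges-from : ∀ f v → (∀ x y → x ≢ v → f (x , y) ≈ ε) → ∑ f edges ≈ ∑ (guarded f v) (allFin n)
    ∑-edges-from f v f≈ε = ≈-trans (∑-edges f) (∑-allFin _ v (λ x x≢v →
      ≈-trans (∑-cong (allFin n) (λ y → guarded-ε {f} x y (f≈ε x y x≢v))) (∑-ε (allFin n))))

    ∑-edges-to : ∀ f v → (∀ x y → y ≢ v → f (x , y) ≈ ε) → ∑ f edges ≈ ∑ (λ x → guarded f x v) (allFin n)
    ∑-edges-to f v f≈ε = ≈-trans (∑-edges f) (∑-cong (allFin n) (λ x →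
      ∑-allFin _ v (λ y y≢v → guarded-ε {f} x y (f≈ε x y y≢v))))

    ∑-edges-at : ∀ f u v → (∀ x y → x ≢ u ⊎ y ≢ v → f (x , y) ≈ ε) → ∑ f edges ≈ guarded f u v
    ∑-edges-at f u v f≈ε = ≈-trans (∑-edges-from f u (λ x y x≢u → f≈ε x y (inj₁ x≢u)))
      (∑-allFin _ v (λ y y≢v → guarded-ε {f} u y (f≈ε u y (inj₂ y≢v))))

  module ℕE = EdgeSum ℕ.+-0-commutativeMonoid
  module 𝔹E = EdgeSum (CommutativeRing.+-commutativeMonoid 𝔹.xor-∧-commutativeRing)

  outdeg-edges : ∀ v → outdeg v edges ≡ ℕΣ.∑ (λ y → ⟦ forward v y ⟧) (allFin n)
  outdeg-edges v = trans (ℕE.∑-edges-from _ v (λ x y x≢v → cong ⟦_⟧ (δ-≢ x≢v)))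
    (ℕΣ.∑-cong (allFin n) (λ y → cong (λ b → if forward v y then ⟦ b ⟧ else 0) (δ-refl v)))

  indeg-edges : ∀ v → indeg v edges ≡ ℕΣ.∑ (λ x → ⟦ forward x v ⟧) (allFin n)
  indeg-edges v = trans (ℕE.∑-edges-to _ v (λ x y y≢v → cong ⟦_⟧ (δ-≢ y≢v)))
    (ℕΣ.∑-cong (allFin n) (λ x → cong (λ b → if forward x v then ⟦ b ⟧ else 0) (δ-refl v)))

  degree-edges : ∀ v → outdeg v edges + indeg v edges ≡ degree G v
  degree-edges v = trans (cong₂ _+_ (outdeg-edges v) (indeg-edges v))
    (trans (≡-sym (ℕΣ.∑-∙ _ _ (allFin n))) (ℕΣ.∑-cong (allFin n) (forward-+ v)))

  arcs-edges : ∀ u v → arcs edges u v ≡ adj G u v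
  -- `edge` is a sum of two indicators, each of which singles out one ordered pair.
  arcs-edges u v = trans (𝔹Σ.∑-∙ _ _ edges) (trans (cong₂ _xor_ (pick u v) (pick v u)) (forward-xor u v))
    where
    isYes-refl : ∀ (x : Fin n) → ⌊ x ≟ x ⌋ ≡ true
    isYes-refl x = trans (isYes≗does (x ≟ x)) (δ-refl x)
    isYes-≢ : ∀ {x y : Fin n} → x ≢ y → ⌊ x ≟ y ⌋ ≡ false
    isYes-≢ {x} {y} x≢y = trans (isYes≗does (x ≟ y)) (δ-≢ x≢y)
    pick : ∀ u v → 𝔹Σ.∑ (λ (x , y) → ⌊ x ≟ u ⌋ ∧ ⌊ y ≟ v ⌋) edges ≡ forward u v
    pick u v = trans (𝔹E.∑-edges-at (λ (x , y) → ⌊ x ≟ u ⌋ ∧ ⌊ y ≟ v ⌋) u v λ where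
        x y (inj₁ x≢u) → cong (_∧ ⌊ y ≟ v ⌋) (isYes-≢ x≢u)
        x y (inj₂ y≢v) → trans (cong (⌊ x ≟ u ⌋ ∧_) (isYes-≢ y≢v)) (𝔹.∧-zeroʳ ⌊ x ≟ u ⌋))
      (trans (cong (λ b → if forward u v then b else false) (cong₂ _∧_ (isYes-refl u) (isYes-refl v)))
        (if-true (forward u v)))
      where
      if-true : ∀ b → (if b then true else false) ≡ b
      if-true true  = refl
      if-true false = refl

  record BalancedOrientation (F : List (Arc n)) : Set where
    field
      near : ∀ v → Near (outdeg v F) (indeg v F)
      degrees : ∀ v → outdeg v F + indeg v F ≡ degree G v
      adjacency : ∀ u v → arcs F u v ≡ adj G u v

  balanced-orientation-of : ∃ BalancedOrientation
  -- No extra set is balanced here, whence `const false`. The arcs in `Q` are the ones to be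
  -- reversed.
  balanced-orientation-of with Orientation.balanced-orientation _≟_ id (const false) edges
  ... | P , Q , p , near , _ = P ++ map ×.swap Q , record
    { near = λ v → Near-≡ (≡-sym (flip-sum (⟦_⟧ ∘ δ v ∘ proj₁))) (≡-sym (flip-sum (⟦_⟧ ∘ δ v ∘ proj₂))) (near v)
    ; degrees = λ v → trans (cong₂ _+_ (flip-sum (⟦_⟧ ∘ δ v ∘ proj₁)) (flip-sum (⟦_⟧ ∘ δ v ∘ proj₂)))
        (trans (regroup (outdeg v P) (indeg v Q) (indeg v P) (outdeg v Q))
        (trans (cong₂ _+_ (≡-sym (total v proj₁)) (≡-sym (total v proj₂))) (degree-edges v)))
    ; adjacency = λ u v → trans (𝔹Σ.∑-++ _ P (map ×.swap Q))
        (trans (cong (arcs P u v xor_) (trans (𝔹Σ.∑-map _ ×.swap Q) (𝔹Σ.∑-cong Q (λ (x , y) → edge-comm y x u v))))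
        (trans (≡-sym (𝔹Σ.∑-++ _ P Q)) (trans (≡-sym (𝔹Σ.∑-↭ _ p)) (arcs-edges u v)))) }
    where
    flip-sum : ∀ (f : Arc n → ℕ) → ℕΣ.∑ f (P ++ map ×.swap Q) ≡ ℕΣ.∑ f P + ℕΣ.∑ (f ∘ ×.swap) Q
    flip-sum f = trans (ℕΣ.∑-++ f P _) (cong (ℕΣ.∑ f P +_) (ℕΣ.∑-map f ×.swap Q))
    total : ∀ v (end : Arc n → Fin n) → # (δ v ∘ end) edges ≡ # (δ v ∘ end) P + # (δ v ∘ end) Q
    total v end = trans (ℕΣ.∑-↭ _ p) (ℕΣ.∑-++ _ P Q)
    regroup : ∀ a b c d → (a + b) + (c + d) ≡ (a + d) + (c + b)
    regroup = solve 4 (λ a b c d → (a :+ b) :+ (c :+ d) := (a :+ d) :+ (c :+ b)) refl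
      where open +-*-Solver using (solve; con; _:+_; _:*_; _:=_)

-- Padding with loops

slack : ℕ → ℕ → ℕ → ℕ
slack k o i = k ∸ (o ⊔ i)

odd : ℕ → ℕ
odd d = ⟦ d % 2 ≡ᵇ 1 ⟧

odd-+ : ∀ m → odd (m + m) ≡ 0
odd-+ m = cong (λ r → ⟦ r ≡ᵇ 1 ⟧)
  (trans (cong (_% 2) (solve 1 (λ m → m :+ m := m :* con 2) refl m)) (m*n%n≡0 m 2))
  where open +-*-Solver using (solve; con; _:+_; _:*_; _:=_)

odd-+suc : ∀ m → odd (m + suc m) ≡ 1
odd-+suc m = cong (λ r → ⟦ r ≡ᵇ 1 ⟧)
  (trans (cong (_% 2) (solve 1 (λ m → m :+ (con 1 :+ m) := con 1 :+ m :* con 2) refl m)) ([m+kn]%n≡m%n 1 m 2))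
  where open +-*-Solver using (solve; con; _:+_; _:*_; _:=_)

-- The loops raise the larger of `o` and `i` to `k`; the smaller one then becomes `k` as well, or k
-- - 1 if `o + i` is odd.
Slack : ℕ → ℕ → ℕ → Set
Slack k o i = o + slack k o i ≤ k × i + slack k o i ≤ k ×
  (o + slack k o i) + (i + slack k o i) + odd (o + i) ≡ 2 * k

Slack-sym : ∀ {k o i} → Slack k o i → Slack k i o
Slack-sym {k} {o} {i} (p , q , eq) rewrite ℕ.⊔-comm i o | ℕ.+-comm i o =
  q , p , trans (cong (_+ odd (o + i)) (ℕ.+-comm (i + (k ∸ (o ⊔ i))) _)) eq

double-≤ : ∀ {k} m → m + m ≤ 2 * k → m ≤ k
double-≤ {k} m le = ℕ.*-cancelˡ-≤ 2 (subst (_≤ 2 * k) (cong (m +_) (≡-sym (ℕ.+-identityʳ m))) le)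

double-< : ∀ {k} m → m + suc m ≤ 2 * k → m < k
double-< {k} m le = ℕ.*-cancelˡ-< 2 m k (subst (_≤ 2 * k)
  (trans (ℕ.+-suc m m) (cong (λ x → suc (m + x)) (≡-sym (ℕ.+-identityʳ m)))) le)

slack-≡ : ∀ {k} m → m + m ≤ 2 * k → Slack k m m
slack-≡ {k} m le rewrite ℕ.⊔-idem m | odd-+ m | ℕ.m+[n∸m]≡n (double-≤ {k} m le) =
  ℕ.≤-refl , ℕ.≤-refl , solve 1 (λ k → k :+ k :+ con 0 := con 2 :* k) refl k
  where open +-*-Solver using (solve; con; _:+_; _:*_; _:=_)

slack-< : ∀ {k} m → m + suc m ≤ 2 * k → Slack k m (suc m)
slack-< {k} m le rewrite ℕ.m≤n⇒m⊔n≡n (ℕ.n≤1+n m) | odd-+suc m with ℕ.m≤n⇒∃[o]m+o≡n (double-< {k} m le)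
... | s , refl rewrite ℕ.m+n∸m≡n (suc m) s = ℕ.n≤1+n _ , ℕ.≤-refl ,
  solve 2 (λ m s → (m :+ s) :+ (con 1 :+ m :+ s) :+ con 1 := con 2 :* (con 1 :+ m :+ s)) refl m s
  where open +-*-Solver using (solve; con; _:+_; _:*_; _:=_)

-- Near degrees are equal or consecutive. In the second case their sum is odd, so it is strictly
-- below 2k and the larger one is still at most `k`.
slack-spec : ∀ {k o i} → Near o i → o + i ≤ 2 * k → Slack k o i
slack-spec {k} {o} {i} (o≤ , i≤) le with ℕ.<-cmp o i
... | tri≈ _ refl _ = slack-≡ o le
... | tri< o<i _ _ rewrite ℕ.≤-antisym i≤ o<i = slack-< o le
... | tri> _ _ i<o rewrite ℕ.≤-antisym o≤ i<o =
  Slack-sym {k} {i} {suc i} (slack-< i (subst (_≤ 2 * k) (ℕ.+-comm (suc i) i) le))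

#-true : ∀ (xs : List A) → # (const true) xs ≡ length xs
#-true []       = refl
#-true (x ∷ xs) = cong suc (#-true xs)

∑-# : ∀ (f : A → Fin n) xs → ℕΣ.∑ (λ v → # (δ v ∘ f) xs) (allFin n) ≡ length xs
∑-# {n = n} f xs = begin
  ℕΣ.∑ (λ v → # (δ v ∘ f) xs) (allFin n)
    ≡⟨ ℕΣ.∑-swap (λ v x → ⟦ δ v (f x) ⟧) (allFin n) xs ⟩
  ℕΣ.∑ (λ x → ℕΣ.∑ (λ v → ⟦ δ v (f x) ⟧) (allFin n)) xs
    ≡⟨ ℕΣ.∑-cong xs (λ x → trans (ℕΣ.∑-allFin _ (f x) (λ v v≢ → cong ⟦_⟧ (δ-≢ (v≢ ∘ ≡-sym))))
         (cong ⟦_⟧ (δ-refl (f x)))) ⟩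
  # (const true) xs
    ≡⟨ #-true xs ⟩
  length xs ∎
  where open ≡-Reasoning

length-concat : ∀ (xss : List (List A)) → length (concat xss) ≡ ℕΣ.∑ length xss
length-concat []         = refl
length-concat (xs ∷ xss) = trans (length-++ xs) (cong (length xs +_) (length-concat xss))

∑-const : ∀ c (xs : List A) → ℕΣ.∑ (λ _ → c) xs ≡ length xs * c
∑-const c []       = refl
∑-const c (x ∷ xs) = cong (c +_) (∑-const c xs)

#-filterᵇ : ∀ (p : A → Bool) xs → length (filterᵇ p xs) ≡ # p xs
#-filterᵇ p []       = refl
#-filterᵇ p (x ∷ xs) with p x
... | true  = cong suc (#-filterᵇ p xs)
... | false = #-filterᵇ p xs

-- Loops do not change the parities but make the arc classes of the colouring below miss exactly as
-- many sources and targets as there are odd vertices.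
module _ (G : Graph n) {F : List (Arc n)} (bal : BalancedOrientation G F) (k : ℕ)
  (Δ≤ : ∀ v → degree G v ≤ 2 * k) where
  open BalancedOrientation bal

  σ : Fin n → ℕ
  σ v = slack k (outdeg v F) (indeg v F)

  loops : List (Arc n)
  loops = concatMap (λ v → replicate (σ v) (v , v)) (allFin n)

  padded : List (Arc n)
  padded = F ++ loops

  spec : ∀ v → Slack k (outdeg v F) (indeg v F)
  spec v = slack-spec (near v) (subst (_≤ 2 * k) (≡-sym (degrees v)) (Δ≤ v))

  #-loops : ∀ (f : Arc n → Fin n) → (∀ x → f (x , x) ≡ x) → ∀ v → # (δ v ∘ f) loops ≡ σ v
  #-loops f f-id v = begin
    # (δ v ∘ f) loops
      ≡⟨ ℕΣ.∑-concatMap _ _ (allFin n) ⟩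
    ℕΣ.∑ (λ x → # (δ v ∘ f) (replicate (σ x) (x , x))) (allFin n)
      ≡⟨ ℕΣ.∑-allFin _ v (λ x x≢v → trans (#-replicate x (σ x))
           (trans (cong (λ b → σ x * ⟦ b ⟧) (δ-≢ x≢v)) (ℕ.*-zeroʳ (σ x)))) ⟩
    # (δ v ∘ f) (replicate (σ v) (v , v))
      ≡⟨ #-replicate v (σ v) ⟩
    σ v * ⟦ δ v v ⟧
      ≡⟨ trans (cong (λ b → σ v * ⟦ b ⟧) (δ-refl v)) (ℕ.*-identityʳ (σ v)) ⟩
    σ v ∎
    where
    open ≡-Reasoning
    #-replicate : ∀ x m → # (δ v ∘ f) (replicate m (x , x)) ≡ m * ⟦ δ v x ⟧
    #-replicate x zero    = refl
    #-replicate x (suc m) = cong₂ _+_ (cong (⟦_⟧ ∘ δ v) (f-id x)) (#-replicate x m)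

  outdeg-padded : ∀ v → outdeg v padded ≡ outdeg v F + σ v
  outdeg-padded v = trans (ℕΣ.∑-++ _ F loops) (cong (outdeg v F +_) (#-loops proj₁ (λ _ → refl) v))

  indeg-padded : ∀ v → indeg v padded ≡ indeg v F + σ v
  indeg-padded v = trans (ℕΣ.∑-++ _ F loops) (cong (indeg v F +_) (#-loops proj₂ (λ _ → refl) v))

  outdeg-padded-≤ : ∀ v → outdeg v padded ≤ k
  outdeg-padded-≤ v = subst (_≤ k) (≡-sym (outdeg-padded v)) (proj₁ (spec v))

  indeg-padded-≤ : ∀ v → indeg v padded ≤ k
  indeg-padded-≤ v = subst (_≤ k) (≡-sym (indeg-padded v)) (proj₁ (proj₂ (spec v)))

  arcs-padded : ∀ u v → arcs padded u v ≡ adj G u v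
  arcs-padded u v = trans (𝔹Σ.∑-++ _ F loops) (trans (cong (arcs F u v xor_) no-loops)
    (trans (𝔹.xor-identityʳ _) (adjacency u v)))
    where
    arcs-replicate : ∀ x m → arcs (replicate m (x , x)) u v ≡ false
    arcs-replicate x zero    = refl
    arcs-replicate x (suc m) = cong₂ _xor_ (edge-self x u v) (arcs-replicate x m)
    no-loops : arcs loops u v ≡ false
    no-loops = trans (𝔹Σ.∑-concatMap _ _ (allFin n))
      (trans (𝔹Σ.∑-cong (allFin n) (λ x → arcs-replicate x (σ x))) (𝔹Σ.∑-ε (allFin n)))

  -- Out- and indegree add up to 2k at an even vertex and to 2k - 1 at an odd one, and summing over
  -- all vertices counts every arc twice.
  length-padded : 2 * length padded + vOdd G ≡ n * (2 * k)
  length-padded = begin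
    2 * length padded + vOdd G
      ≡⟨ cong₂ _+_ (trans (cong (length padded +_) (ℕ.+-identityʳ (length padded)))
           (cong₂ _+_ (≡-sym (∑-# proj₁ padded)) (≡-sym (∑-# proj₂ padded)))) (#-filterᵇ _ (allFin n)) ⟩
    (ℕΣ.∑ (λ v → outdeg v padded) (allFin n) + ℕΣ.∑ (λ v → indeg v padded) (allFin n))
      + ℕΣ.∑ (odd ∘ degree G) (allFin n)
      ≡⟨ trans (cong (_+ ℕΣ.∑ (odd ∘ degree G) (allFin n)) (≡-sym (ℕΣ.∑-∙ _ _ (allFin n))))
           (≡-sym (ℕΣ.∑-∙ _ _ (allFin n))) ⟩
    ℕΣ.∑ (λ v → outdeg v padded + indeg v padded + odd (degree G v)) (allFin n)
      ≡⟨ ℕΣ.∑-cong (allFin n) (λ v → trans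
           (cong₂ _+_ (cong₂ _+_ (outdeg-padded v) (indeg-padded v)) (cong odd (≡-sym (degrees v))))
           (proj₂ (proj₂ (spec v)))) ⟩
    ℕΣ.∑ (λ _ → 2 * k) (allFin n)
      ≡⟨ ∑-const (2 * k) (allFin n) ⟩
    length (allFin n) * (2 * k)
      ≡⟨ cong (_* (2 * k)) (length-tabulate {n = n} id) ⟩
    n * (2 * k) ∎
    where open ≡-Reasoning

-- Splitting the arcs evenly at every vertex

sources targets : List (Arc n → Bool)
sources = map (λ v → δ v ∘ proj₁) (allFin _)
targets = map (λ v → δ v ∘ proj₂) (allFin _)

-- The test `const true` counts all arcs and so makes the sizes of the classes nearly equal; the
-- others count the arcs leaving or entering a vertex.
tests : List (Arc n → Bool)
tests = const true ∷ sources ++ targets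

All-tests : ∀ {P : (Arc n → Bool) → Set} → P (const true) →
  (∀ v → P (δ v ∘ proj₁)) → (∀ v → P (δ v ∘ proj₂)) → All P tests
All-tests p ps qs = p ∷ All.++⁺ (All.map⁺ (All.universal ps (allFin _))) (All.map⁺ (All.universal qs (allFin _)))

source∈ : ∀ (v : Fin n) → δ v ∘ proj₁ ∈ tests
source∈ v = there (∈-++⁺ˡ (∈-map⁺ (λ v → δ v ∘ proj₁) (∈-allFin v)))

target∈ : ∀ (v : Fin n) → δ v ∘ proj₂ ∈ tests
target∈ v = there (∈-++⁺ʳ sources (∈-map⁺ (λ v → δ v ∘ proj₂) (∈-allFin v)))

-- Orient the bipartite graph with an edge from the left copy of x to the right copy of y for each
-- arc (x , y): an arc is in the first half if its edge runs from left to right.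
halve-arcs : ∀ (L : List (Arc n)) → ∃₂ λ P Q → L ↭ P ++ Q × All (λ t → Near (# t P) (# t Q)) tests
halve-arcs {n} L with balanced-orientation ends isLeft L
  where
  open Orientation (⊎.≡-dec (_≟_ {n}) (_≟_ {n}))
  ends : Arc n → (Fin n ⊎ Fin n) × (Fin n ⊎ Fin n)
  ends (x , y) = inj₁ x , inj₂ y
  isLeft : Fin n ⊎ Fin n → Bool
  isLeft = [ const true , const false ]′
... | P , Q , p , near , nearˡ = P , Q , p , All-tests
  (Near-≡ (left (const true)) (right (const true)) nearˡ)
  (λ v → Near-≡ (left (δ v ∘ proj₁)) (right (δ v ∘ proj₁)) (near (inj₁ v)))
  -- At a right copy the arcs in `P` enter and those in `Q` leave, so the two counts come in the
  -- opposite order.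
  (λ v → Near-sym (Near-≡ (right (δ v ∘ proj₂)) (left (δ v ∘ proj₂)) (near (inj₂ v))))
  where
  left : ∀ (t : Arc n → Bool) → # t P + # {A = Arc n} (const false) Q ≡ # t P
  left t = trans (cong (# t P +_) (ℕΣ.∑-ε Q)) (ℕ.+-identityʳ _)
  right : ∀ (t : Arc n → Bool) → # {A = Arc n} (const false) P + # t Q ≡ # t Q
  right t = cong (_+ # t Q) (ℕΣ.∑-ε P)

#≤0⇒∉ : ∀ (f : A → Fin n) {v} xs → # (δ v ∘ f) xs ≤ 0 → All (v ≢_) (map f xs)
#≤0⇒∉ f []       _  = []
#≤0⇒∉ f {v} (x ∷ xs) le with f x ≟ v
... | no fx≢v = fx≢v ∘ ≡-sym ∷ #≤0⇒∉ f xs le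

#≤1⇒Unique : ∀ (f : A → Fin n) xs → (∀ v → # (δ v ∘ f) xs ≤ 1) → Unique (map f xs)
#≤1⇒Unique f []       _  = []
#≤1⇒Unique f (x ∷ xs) le =
  #≤0⇒∉ f xs (s≤s⁻¹ (subst (λ b → ⟦ b ⟧ + # (δ (f x) ∘ f) xs ≤ 1) (δ-refl (f x)) (le (f x)))) ∷
  #≤1⇒Unique f xs (λ v → ℕ.≤-trans (ℕ.m≤n+m _ _) (le v))

CoveredBy-resp : ∀ {f g : Fin n → Fin n → Bool} {k l} → (∀ u v → f u v ≡ g u v) → k ≤ l →
  CoveredBy f k → CoveredBy g l
CoveredBy-resp f≡g k≤l (Ps , paths , eq , len) =
  Ps , paths , (λ u v → trans (eq u v) (f≡g u v)) , ℕ.≤-trans len k≤l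

cover-concat : ∀ {g : List (Arc n) → ℕ} {Xs} → All (λ X → CoveredBy (arcs X) (g X)) Xs →
  CoveredBy (arcs (concat Xs)) (ℕΣ.∑ g Xs)
cover-concat [] = [] , [] , (λ u v → refl) , z≤n
cover-concat {Xs = X ∷ Xs} ((Ps , paths , eq , len) ∷ covers) with cover-concat covers
... | Qs , paths′ , eq′ , len′ = Ps ++ Qs , All.++⁺ paths paths′ ,
  (λ u v → trans (𝔹Σ.∑-++ (λ P → pathEdge P u v) Ps Qs)
    (trans (cong₂ _xor_ (eq u v) (eq′ u v)) (≡-sym (𝔹Σ.∑-++ _ X (concat Xs))))) ,
  subst (_≤ _) (≡-sym (length-++ Ps)) (ℕ.+-mono-≤ len len′)

Near-∸ : ∀ n {a b} → Near a b → Near (n ∸ a) (n ∸ b)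
Near-∸ n (a≤ , b≤) = below n b≤ , below n a≤
  where
  ∸-suc-≤ : ∀ m a → m ∸ a ≤ suc (m ∸ suc a)
  ∸-suc-≤ zero    a       = ℕ.≤-trans (ℕ.≤-reflexive (ℕ.0∸n≡0 a)) z≤n
  ∸-suc-≤ (suc m) zero    = ℕ.≤-refl
  ∸-suc-≤ (suc m) (suc a) = ∸-suc-≤ m a
  below : ∀ n {a b} → b ≤ suc a → n ∸ a ≤ suc (n ∸ b)
  below n {a} b≤ = ℕ.≤-trans (∸-suc-≤ n a) (s≤s (ℕ.∸-monoʳ-≤ n b≤))

-- By `near-threshold` the same argument of the maximum wins in all terms, so the maximum can be
-- taken after summing.
∑-⊔2 : ∀ (f : A → ℕ) xs → AllPairs (λ x y → Near (f x) (f y)) xs →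
  ℕΣ.∑ (λ x → f x ⊔ 2) xs ≤ ℕΣ.∑ f xs ⊔ 2 * length xs
∑-⊔2 f xs near with near-threshold f 2 near
... | inj₁ below = ℕ.≤-trans
  (∑-mono-≤ xs (All.map (λ le → ℕ.≤-reflexive (ℕ.m≤n⇒m⊔n≡n le)) below))
  (ℕ.≤-trans (ℕ.≤-reflexive (trans (∑-const 2 xs) (ℕ.*-comm (length xs) 2))) (ℕ.m≤n⊔m (ℕΣ.∑ f xs) _))
... | inj₂ above = ℕ.≤-trans
  (∑-mono-≤ xs (All.map (λ le → ℕ.≤-reflexive (ℕ.m≥n⇒m⊔n≡m le)) above))
  (ℕ.m≤m⊔n _ _)

-- Covering the classes of the splitting

module _ (G : Graph n) {F : List (Arc n)} (bal : BalancedOrientation G F) (k : ℕ)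
  (Δ≤ : ∀ v → degree G v ≤ 2 * k) {Xs : List (List (Arc n))} (len : length Xs ≡ k)
  (cat : concat Xs ↭ padded G bal k Δ≤)
  (even : AllPairs (λ X Y → All (λ t → Near (# t X) (# t Y)) tests) Xs) where

  private
    L : List (Arc n)
    L = padded G bal k Δ≤

  -- For a class in `Xs` the subtraction is exact, by `cover-class`, and gives the number of its
  -- paths.
  missing : List (Arc n) → ℕ
  missing X = n ∸ length X

  -- At most `k` arcs pass the test, and the `k` classes share them evenly.
  at-most-one : ∀ {t} → t ∈ tests → # t L ≤ k → All (λ X → # t X ≤ 1) Xs
  at-most-one {t} t∈ le = near⇒All≤1 (# t) Xs (AllPairs.map (λ e → All.lookup e t∈) even)
    (subst₂ _≤_ (trans (≡-sym (ℕΣ.∑-↭ _ cat)) (ℕΣ.∑-concat _ Xs)) (≡-sym len) le)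

  unique-sources : ∀ {X} → X ∈ Xs → Unique (map proj₁ X)
  unique-sources {X} X∈ = #≤1⇒Unique proj₁ X
    (λ v → All.lookup (at-most-one (source∈ v) (outdeg-padded-≤ G bal k Δ≤ v)) X∈)

  unique-targets : ∀ {X} → X ∈ Xs → Unique (map proj₂ X)
  unique-targets {X} X∈ = #≤1⇒Unique proj₂ X
    (λ v → All.lookup (at-most-one (target∈ v) (indeg-padded-≤ G bal k Δ≤ v)) X∈)

  cover-class : ∀ {X} → X ∈ Xs → missing X + length X ≡ n × CoveredBy (arcs X) (missing X ⊔ 2)
  cover-class {X} X∈ =
    let m , eq , cover = cover-partial-injection X (unique-sources X∈) (unique-targets X∈)
        m≡ = trans (≡-sym (ℕ.m+n∸n≡m m (length X))) (cong (_∸ length X) eq)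
    in subst (λ m → m + length X ≡ n × CoveredBy (arcs X) (m ⊔ 2)) m≡ (eq , cover)

  covers : All (λ X → CoveredBy (arcs X) (missing X ⊔ 2)) Xs
  covers = All.tabulate (proj₂ ∘ cover-class)

  arcs-≡ : ∀ u v → arcs (concat Xs) u v ≡ adj G u v
  arcs-≡ u v = trans (𝔹Σ.∑-↭ _ cat) (arcs-padded G bal k Δ≤ u v)

  ∑-missing : ℕΣ.∑ missing Xs + length L ≡ k * n
  ∑-missing = begin
    ℕΣ.∑ missing Xs + length L
      ≡⟨ cong (ℕΣ.∑ missing Xs +_) (trans (≡-sym (↭.↭-length cat)) (length-concat Xs)) ⟩
    ℕΣ.∑ missing Xs + ℕΣ.∑ length Xs
      ≡⟨ ℕΣ.∑-∙ missing length Xs ⟨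
    ℕΣ.∑ (λ X → missing X + length X) Xs
      ≡⟨ ℕΣ.∑-cong∈ Xs (proj₁ ∘ cover-class) ⟩
    ℕΣ.∑ (λ _ → n) Xs
      ≡⟨ ∑-const n Xs ⟩
    length Xs * n
      ≡⟨ cong (_* n) len ⟩
    k * n ∎
    where open ≡-Reasoning

  -- `length-padded` and `∑-missing` count the same total. In particular `vOdd G` is even, so
  -- halving it in the bound is exact.
  vOdd≡ : vOdd G ≡ ℕΣ.∑ missing Xs * 2
  vOdd≡ = ℕ.+-cancelˡ-≡ (2 * length L) _ _ (trans (length-padded G bal k Δ≤) (begin
    n * (2 * k)
      ≡⟨ solve 2 (λ n k → n :* (con 2 :* k) := con 2 :* (k :* n)) refl n k ⟩
    2 * (k * n)
      ≡⟨ cong (2 *_) ∑-missing ⟨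
    2 * (ℕΣ.∑ missing Xs + length L)
      ≡⟨ solve 2 (λ m l → con 2 :* (m :+ l) := con 2 :* l :+ m :* con 2) refl (ℕΣ.∑ missing Xs) (length L) ⟩
    2 * length L + ℕΣ.∑ missing Xs * 2 ∎))
    where
    open ≡-Reasoning
    open +-*-Solver using (solve; con; _:+_; _:*_; _:=_)

  near-missing : AllPairs (λ X Y → Near (missing X) (missing Y)) Xs
  near-missing = AllPairs.map (λ {X} {Y} e → Near-∸ n (Near-≡ (#-true X) (#-true Y) (All.head e))) even

  size : ℕΣ.∑ (λ X → missing X ⊔ 2) Xs ≤ (vOdd G / 2) ⊔ (2 * k)
  size = subst₂ (λ m l → ℕΣ.∑ (λ X → missing X ⊔ 2) Xs ≤ m ⊔ 2 * l)
    (≡-sym (trans (cong (_/ 2) vOdd≡) (m*n/n≡m (ℕΣ.∑ missing Xs) 2))) len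
    (∑-⊔2 missing Xs near-missing)

  cover-from-colouring : CoveredBy (adj G) ((vOdd G / 2) ⊔ (2 * k))
  cover-from-colouring = CoveredBy-resp arcs-≡ size (cover-concat covers)

-- The bound in terms of the maximum degree

cover-bounded-degree : ∀ (G : Graph n) k → (∀ v → degree G v ≤ 2 * k) → CoveredBy (adj G) ((vOdd G / 2) ⊔ (2 * k))
cover-bounded-degree G k Δ≤ = colour k Δ≤ (balanced-orientation-of G)
  where
  colour : ∀ k → (∀ v → degree G v ≤ 2 * k) → ∃ (BalancedOrientation G) →
    CoveredBy (adj G) ((vOdd G / 2) ⊔ (2 * k))
  -- `equitable` produces at least one class, so `k = 0` is separate: all degrees are 0 and `F` can
  -- have no arc.
  colour zero Δ≤0 ([] , bal) = [] , [] , BalancedOrientation.adjacency bal , z≤n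
  colour zero Δ≤0 ((x , y) ∷ F , bal) = contradiction
    (ℕ.≤-trans (ℕ.≤-trans (ℕ.m≤m+n _ _) (ℕ.≤-reflexive (BalancedOrientation.degrees bal x))) (Δ≤0 x))
    (subst (λ b → ¬ ⟦ b ⟧ + outdeg x F ≤ 0) (≡-sym (δ-refl x)) λ ())
  colour (suc k) Δ≤ (F , bal) = finish (Equitable.equitable tests halve-arcs k (padded G bal (suc k) Δ≤))
    where
    finish : Equitable.Refinement tests halve-arcs (padded G bal (suc k) Δ≤) (suc k) → CoveredBy (adj G) _
    finish (Xs , len , cat , even) = cover-from-colouring G bal (suc k) Δ≤ len cat even

degree≤maxDegree : ∀ (G : Graph n) v → degree G v ≤ maxDegree G
degree≤maxDegree G v = ≤-max (∈-map⁺ (degree G) (∈-allFin v))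
  where
  ≤-max : ∀ {m ms} → m ∈ ms → m ≤ foldr _⊔_ 0 ms
  ≤-max (here refl) = ℕ.m≤m⊔n _ _
  ≤-max (there m∈)  = ℕ.≤-trans (≤-max m∈) (ℕ.m≤n⊔m _ _)

-- The ceiling of m/2 is encoded as `(m + 1) / 2`; the remainder of m + 1 is at most one.
n≤2*⌈n/2⌉ : ∀ m → m ≤ 2 * ((m + 1) / 2)
n≤2*⌈n/2⌉ m = s≤s⁻¹ (begin
  suc m                          ≡⟨ ℕ.+-comm 1 m ⟩
  m + 1                          ≡⟨ m≡m%n+[m/n]*n (m + 1) 2 ⟩
  (m + 1) % 2 + (m + 1) / 2 * 2  ≤⟨ ℕ.+-mono-≤ (s≤s⁻¹ (m%n<n (m + 1) 2)) (ℕ.≤-reflexive (ℕ.*-comm ((m + 1) / 2) 2)) ⟩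
  suc (2 * ((m + 1) / 2))        ∎)
  where open ℕ.≤-Reasoning

theorem1p3 : ∀ (n : ℕ) (G : Graph n) → p₂≤ G ((vOdd G / 2) ⊔ (2 * ((maxDegree G + 1) / 2)))
theorem1p3 n G =
  let Ps , paths , parities , len = cover-bounded-degree G ((maxDegree G + 1) / 2)
        (λ v → ℕ.≤-trans (degree≤maxDegree G v) (n≤2*⌈n/2⌉ (maxDegree G)))
  in Ps , (paths , parities) , len
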